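{- Let $n\ge 1$, let $q\ge 1$ be a real number and let $x_1,\dots,x_n$ be positive real numbers with $x_1+\cdots+x_n=1$. Let $\mathcal{T}_{\mathfrak{S}_n}(q,{\sf x})$ be the $q$-Tsetlin library on permutations (defined in the context). For $\pi\in\mathfrak{S}_n$ define \[ \Psi(q,{\sf x})_\pi=\frac{q^{ -\mathrm{inv}(\pi)}}{\prod_{k=1}^{n-1}\left(\kappa(w_0;{\sf x})-q^{k-n-1}\kappa(\pi_1,\dots,\pi_{k-1};{\sf x})\right)}\times\left(\prod_{\substack{1\le k\le n-1\\ k\in \mathrm{LRM}(\pi)}}\kappa(\pi_k;{\sf x})\prod_{\substack{1\le k\le n-1\\ k\notin\mathrm{LRM}(\pi)}}\Big(\kappa(\pi_{p_k},\dots,\pi_k;{\sf x})-q^{ -1}\kappa(\pi_{p_k},\dots,\pi_{k-1};{\sf x})\Big)\right), \] where $\kappa(w_0;{\sf x})=x_1+\cdots+x_n$. Then: (1) the row vector $\Psi(q,{\sf x})=(\Psi(q,{\sf x})_\pi)_{\pi\in\mathfrak{S}_n}$ is the stationary distribution of the $q$-Tsetlin library, i.e. $\Psi(q,{\sf x})\cdot\mathcal{T}_{\mathfrak{S}_n}(q,{\sf x})=(x_1+\cdots+x_n)\Psi(q,{\sf x})$; (2) each factor (in numerator and denominator) of $\Psi(q,{\sf x})_\pi$ is positive; (3) $\sum_{\pi\in\mathfrak{S}_n}\Psi(q,{\sf x})_\pi=1$.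
   Context: Permutations $\pi\in\mathfrak{S}_n$ are written in one-line notation $\pi=\pi_1\pi_2\cdots\pi_n$; for $1\le i\le n-1$, $\pi s_i$ denotes $\pi$ with the entries in positions $i$ and $i+1$ swapped. Let $V$ be the real vector space with basis $\mathfrak{S}_n$. The Hecke generators $T_1,\dots,T_{n-1}$ act on $V$ on the right by $\pi\cdot T_i=q\,\pi s_i$ if $\pi_{i+1}<\pi_i$, and $\pi\cdot T_i=\pi s_i+(q-1)\pi$ if $\pi_{i+1}>\pi_i$. Let $\mathcal{X}$ be the linear map $\pi\cdot\mathcal{X}=\frac{x_{\pi_1}}{q^{n-\pi_1}}\pi$. The $q$-Tsetlin library on permutations is the right operator $\mathcal{T}_{\mathfrak{S}_n}(q,{\sf x})=\sum_{i=1}^n T_{i-1}T_{i-2}\cdots T_1\,\mathcal{X}$, i.e. $\pi\cdot\mathcal{T}_{\mathfrak{S}_n}(q,{\sf x})=\sum_{i=1}^n\big((\cdots((\pi\cdot T_{i-1})\cdot T_{i-2})\cdots)\cdot T_1\big)\cdot\mathcal{X}$, where the $i=1$ term is $\pi\cdot\mathcal{X}$; its matrix (row $\pi$, column $\sigma$ = coefficient of $\sigma$ in $\pi\cdot\mathcal{T}_{\mathfrak{S}_n}(q,{\sf x})$) is the transition matrix of a Markov chain on $\mathfrak{S}_n$. For a weakly decreasing tuple ${\sf b}=(b_1,\dots,b_k)$ of elements of $[n]$, $\kappa({\sf b};{\sf x})=\sum_{i=1}^k x_{b_i}q^{i+b_i-k-1}$; for an arbitrary tuple, $\kappa({\sf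 b};{\sf x})$ is $\kappa$ of its weakly decreasing rearrangement; the empty tuple gives $0$; $w_0=n\,(n-1)\cdots 1$. A position $j$ is a left-to-right minimum of $\pi$ if $\pi_i>\pi_j$ for all $i<j$; $\mathrm{LRM}(\pi)$ is the set of such positions. For $k\notin\mathrm{LRM}(\pi)$, $p_k$ is the smallest position $i<k$ with $\pi_i<\pi_k$. $\mathrm{inv}(\pi)$ is the number of pairs $i<j$ with $\pi_i>\pi_j$. -}

module Defs where

open import Level using (Level; _⊔_) renaming (suc to lsuc)
open import Data.Nat as ℕ using (ℕ; zero; suc; _∸_; _<ᵇ_; _≡ᵇ_)
open import Data.Integer as ℤ using (ℤ; +_; -[1+_])
import Data.Bool
open import Data.Bool using (Bool; true; false; if_then_else_; _∧_; not)
open import Data.List using (List; []; _∷_; map; concatMap; upTo; filterᵇ; foldr; take; drop; length; reverse; _++_)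
open import Data.Sum using (_⊎_)
open import Data.Product using (_×_; _,_)
open import Relation.Nullary using (¬_)
open import Relation.Binary.Core using (Rel)
open import Relation.Binary.Structures using (IsStrictTotalOrder)
open import Algebra.Bundles using (CommutativeRing)

record OrderedField (c ℓ : Level) : Set (lsuc (c ⊔ ℓ)) where
  field
    commutativeRing : CommutativeRing c ℓ
  open CommutativeRing commutativeRing public
  infix 4 _<_
  field
    _<_                : Rel Carrier ℓ
    isStrictTotalOrder : IsStrictTotalOrder _≈_ _<_
    0<1                : 0# < 1#
    +-mono-<           : ∀ {a b} z → a < b → (a + z) < (b + z)
    *-pos              : ∀ {a b} → 0# < a → 0# < b → 0# < (a * b)
    _⁻¹                : Carrier → Carrier
    ⁻¹-inverse         : ∀ a → ¬ (a ≈ 0#) → (a * (a ⁻¹)) ≈ 1#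

  _≤F_ : Rel Carrier ℓ
  a ≤F b = (a < b) ⊎ (a ≈ b)

-- Combinatorics on words over ℕ; permutations of [n] are lists of
-- length n listing 1..n in some order.  Positions are 1-based.

anyᵇ : {A : Set} → (A → Bool) → List A → Bool
anyᵇ p = foldr (λ a r → p a Data.Bool.∨ r) false

allᵇ : {A : Set} → (A → Bool) → List A → Bool
allᵇ p = foldr (λ a r → p a ∧ r) true

range : ℕ → List ℕ
range m = map suc (upTo m)

words : ℕ → ℕ → List (List ℕ)
words m zero    = [] ∷ []
words m (suc k) = concatMap (λ w → map (λ a → a ∷ w) (range m)) (words m k)

distinct : List ℕ → Bool
distinct []       = true
distinct (a ∷ w)  = not (anyᵇ (λ b → a ≡ᵇ b) w) ∧ distinct w

Sn : ℕ → List (List ℕ)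
Sn n = filterᵇ distinct (words n n)

w0 : ℕ → List ℕ
w0 n = reverse (range n)

-- π_k (1-based), default 0 out of range
at : List ℕ → ℕ → ℕ
at []      _             = 0
at (a ∷ w) zero          = 0
at (a ∷ w) (suc zero)    = a
at (a ∷ w) (suc (suc k)) = at w (suc k)

-- the subword π_a, π_{a+1}, …, π_b  (empty if b < a)
slice : List ℕ → ℕ → ℕ → List ℕ
slice π a b = take (suc b ∸ a) (drop (a ∸ 1) π)

swapAt : ℕ → List ℕ → List ℕ
swapAt zero          w           = w
swapAt (suc zero)    (a ∷ b ∷ w) = b ∷ a ∷ w
swapAt (suc zero)    w           = w
swapAt (suc (suc i)) []          = []
swapAt (suc (suc i)) (a ∷ w)     = a ∷ swapAt (suc i) w

inv : List ℕ → ℕ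
inv []      = 0
inv (a ∷ w) = length (filterᵇ (λ b → b <ᵇ a) w) ℕ.+ inv w

isLRM : List ℕ → ℕ → Bool
isLRM π k = allᵇ (λ i → at π k <ᵇ at π i) (range (k ∸ 1))

-- p_k : smallest position i < k with π_i < π_k (0 if none)
firstBelow : List ℕ → ℕ → List ℕ → ℕ
firstBelow π k []       = 0
firstBelow π k (i ∷ is) = if at π i <ᵇ at π k then i else firstBelow π k is

pPos : List ℕ → ℕ → ℕ
pPos π k = firstBelow π k (range (k ∸ 1))

insertDesc : ℕ → List ℕ → List ℕ
insertDesc a []      = a ∷ []
insertDesc a (b ∷ w) = if b <ᵇ a then a ∷ b ∷ w else b ∷ insertDesc a w

sortDesc : List ℕ → List ℕ
sortDesc = foldr insertDesc []

module Tsetlin {c ℓ} (F : OrderedField c ℓ)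
               (q : OrderedField.Carrier F) (x : ℕ → OrderedField.Carrier F)
               (n : ℕ) where
  open OrderedField F

  powℕ : Carrier → ℕ → Carrier
  powℕ a zero    = 1#
  powℕ a (suc k) = a * powℕ a k

  qpow : ℤ → Carrier
  qpow (+ m)     = powℕ q m
  qpow -[1+ m ]  = powℕ (q ⁻¹) (suc m)

  sumF : List Carrier → Carrier
  sumF = foldr _+_ 0#

  prodF : List Carrier → Carrier
  prodF = foldr _*_ 1#

  κdec : List ℕ → Carrier
  κdec b = sumF (map (λ i → x (at b i) * qpow ((+ i) ℤ.+ (+ at b i) ℤ.- (+ k) ℤ.- (+ 1))) (range k))
    where k = length b

  κ : List ℕ → Carrier
  κ b = κdec (sortDesc b)

  sumX : Carrier
  sumX = sumF (map x (range n))

  -- formal linear combinations of words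
  LC : Set c
  LC = List (Carrier × List ℕ)

  Tword : ℕ → List ℕ → LC
  Tword i π = if at π (suc i) <ᵇ at π i
              then (q , swapAt i π) ∷ []
              else (1# , swapAt i π) ∷ (q - 1# , π) ∷ []

  actT : ℕ → LC → LC
  actT i = concatMap (λ { (a , π) → map (λ { (b , σ) → (a * b , σ) }) (Tword i π) })

  actX : LC → LC
  actX = map (λ { (a , π) → (a * (x (at π 1) * qpow (ℤ.- (+ (n ∸ at π 1)))) , π) })

  actDown : ℕ → LC → LC
  actDown zero    v = v
  actDown (suc j) v = actDown j (actT (suc j) v)

  tsetlin : List ℕ → LC
  tsetlin π = concatMap (λ i → actX (actDown (i ∸ 1) ((1# , π) ∷ []))) (range n)

  eqW : List ℕ → List ℕ → Bool
  eqW []      []      = true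
  eqW (a ∷ v) (b ∷ w) = (a ≡ᵇ b) ∧ eqW v w
  eqW _       _       = false

  coeff : List ℕ → LC → Carrier
  coeff σ v = sumF (map (λ { (a , τ) → if eqW τ σ then a else 0# }) v)

  M : List ℕ → List ℕ → Carrier
  M π σ = coeff σ (tsetlin π)

  Dfac : List ℕ → ℕ → Carrier
  Dfac π k = κ (w0 n) - qpow ((+ k) ℤ.- (+ n) ℤ.- (+ 1)) * κ (take (k ∸ 1) π)

  Nfac : List ℕ → ℕ → Carrier
  Nfac π k = if isLRM π k
             then κ (at π k ∷ [])
             else κ (slice π (pPos π k) k) - (q ⁻¹) * κ (slice π (pPos π k) (k ∸ 1))

  Ψ : List ℕ → Carrier
  Ψ π = qpow (ℤ.- (+ inv π))
        * (prodF (map (Nfac π) (range (n ∸ 1)))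
        * (prodF (map (Dfac π) (range (n ∸ 1)))) ⁻¹)

{-# OPTIONS --safe #-}

-- Reading π from left to right turns Ψ into sequential sampling without replacement. If U is the set of
-- letters already used, then up to a power of q the k-th numerator factor is
--   W U a = x_a + (1 − q⁻¹) Σ_{b ∈ U, b < a} x_b q^{-#{c ∉ U, b < c < a}},   a = π_k,
-- the k-th denominator factor is D U = Σ_{a ∉ U} W U a, and the powers of q multiply to q^{inv π}.
-- So Ψ_π = Π_k W/D: all factors are positive and the total mass is 1. For stationarity write the operator
-- in Horner form, f ↦ f + (f + ⋯) T_1; induction on w shows that re-inserting a into w in all ways gives
-- q^{#{c ∉ U, c > a}} times the weight of sampling w from the complement of U ∪ {a}. The induction step
-- only needs how W and D change when a letter is added to U.

module Submission where

open import Defs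
open import Level using (Level)
open import Data.Nat using (ℕ; _≤_; _∸_)
open import Data.List using (List; map)
open import Data.List.Membership.Propositional using (_∈_)
open import Data.Product using (_×_)
open import Data.Nat as ℕ using (zero; suc; _<ᵇ_; _≡ᵇ_; z≤n; s≤s)
import Data.Nat.Properties as ℕ
open import Data.Integer as ℤ using (ℤ; +_; -[1+_]; _⊖_; _◃_)
import Data.Integer.Properties as ℤ
import Data.Integer.Solver
import Data.Sign as Sign
open import Data.Bool using (Bool; true; false; if_then_else_; _∧_; _∨_; not; T)
open import Data.Bool.Properties using (T?; ∨-assoc; ∨-comm; ∨-identityʳ; ∨-zeroʳ; ∧-zeroʳ; ∧-identityʳ)
open import Data.Empty using (⊥-elim)
open import Data.List using ([]; _∷_; _++_; concatMap; upTo; downFrom; filterᵇ; foldr; take; drop; length)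
open import Data.List.Properties using (upTo-∷ʳ; map-upTo; map-++; map-∘; reverse-upTo; reverse-map)
open import Data.List.Membership.Propositional using (find)
open import Data.List.Membership.Propositional.Properties using (∈-filter⁻; ∈-concatMap⁻; ∈-map⁻; ∈-upTo⁻)
open import Data.List.Relation.Unary.All using (All; []; _∷_)
open import Data.List.Relation.Unary.Any using (here)
open import Data.Maybe using (Maybe; just; nothing)
open import Data.Product using (_,_; proj₁; proj₂; ∃)
open import Data.Sum using (inj₁; inj₂)
open import Data.Unit using (tt)
open import Relation.Nullary using (¬_; yes; no)
open import Relation.Binary.Definitions using (tri<; tri≈; tri>)
open import Relation.Binary.Structures using (IsStrictTotalOrder)
open import Relation.Binary.PropositionalEquality as ≡ using (_≡_; _≢_; cong; cong₂; subst)
open import Algebra.Bundles using (CommutativeRing)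
import Algebra.Properties.AbelianGroup
import Algebra.Properties.Ring
import Algebra.Properties.Semiring.Mult.TCOptimised
import Algebra.Solver.Ring as RingSolver
open import Algebra.Solver.Ring.AlmostCommutativeRing using (fromCommutativeRing; _-Raw-AlmostCommutative⟶_)
import Relation.Binary.Reasoning.Setoid

-- `κ` weights a letter by its rank in a sorted word, so one new letter can shift many exponents.
-- `carry` replaces ranks by a scan through the letter values: a new letter a is felt only from the
-- value a on, and there as a single multiple of `W U a` (`carry-⊕≥`). At `n` this becomes the
-- relation behind the insertion step, `γ U a * D U ≈ γ U a * D (U ⊕ a) + W U a`, which is divided
-- by `D U * D (U ⊕ a)`. If the next letter b exceeds a, then `W` at b changes once a is used, and
-- the diagonal term `q - 1` of the Hecke action supplies exactly this change. The division fails at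
-- the last letter, where `D (U ⊕ a)` is zero, so that case is the base of the induction. With U
-- empty the formula leaves q^(n - a) times the weight of w drawn without a; the diagonal map
-- multiplies by x_a q^(a - n), and x_a is `sumX` times the probability of drawing a first.

-- Ring solver with integer coefficients

module IntegerSolver {c ℓ} (R : CommutativeRing c ℓ) where
  open CommutativeRing R
  open Algebra.Properties.Ring ring using (-‿distribˡ-*; -‿distribʳ-*; -‿involutive; -0#≈0#)
  open Algebra.Properties.AbelianGroup +-abelianGroup using (⁻¹-∙-comm)
  open Algebra.Properties.Semiring.Mult.TCOptimised semiring using (×-homo-+; ×1-homo-*; 1+×) renaming (_×_ to _⊠_)
  open Relation.Binary.Reasoning.Setoid setoid

  ⟦_⟧ᶻ : ℤ → Carrier
  ⟦ + n ⟧ᶻ      = n ⊠ 1#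
  ⟦ -[1+ n ] ⟧ᶻ = - (suc n ⊠ 1#)

  1-cancel : ∀ a b → a - b ≈ (1# + a) - (1# + b)
  1-cancel a b = sym (begin
    (1# + a) + - (1# + b)    ≈⟨ +-cong (+-comm 1# a) (sym (⁻¹-∙-comm 1# b)) ⟩
    (a + 1#) + (- 1# + - b)  ≈⟨ +-assoc a 1# _ ⟩
    a + (1# + (- 1# + - b))  ≈⟨ +-congˡ (sym (+-assoc 1# (- 1#) (- b))) ⟩
    a + ((1# - 1#) - b)      ≈⟨ +-congˡ (+-congʳ (-‿inverseʳ 1#)) ⟩
    a + (0# - b)             ≈⟨ +-congˡ (+-identityˡ (- b)) ⟩
    a - b                    ∎)

  ⊖-homo : ∀ m n → ⟦ m ⊖ n ⟧ᶻ ≈ m ⊠ 1# - n ⊠ 1#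
  ⊖-homo zero    zero    = sym (-‿inverseʳ 0#)
  ⊖-homo zero    (suc n) = sym (+-identityˡ _)
  ⊖-homo (suc m) zero    = sym (trans (+-congˡ -0#≈0#) (+-identityʳ _))
  ⊖-homo (suc m) (suc n) rewrite ℤ.[1+m]⊖[1+n]≡m⊖n m n = begin
    ⟦ m ⊖ n ⟧ᶻ                        ≈⟨ ⊖-homo m n ⟩
    m ⊠ 1# - n ⊠ 1#                   ≈⟨ 1-cancel _ _ ⟩
    (1# + m ⊠ 1#) - (1# + n ⊠ 1#)     ≈⟨ sym (+-cong (1+× m 1#) (-‿cong (1+× n 1#))) ⟩
    suc m ⊠ 1# - suc n ⊠ 1#           ∎

  +ᶻ-homo : ∀ i j → ⟦ i ℤ.+ j ⟧ᶻ ≈ ⟦ i ⟧ᶻ + ⟦ j ⟧ᶻ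
  +ᶻ-homo (+ m)    (+ n)    = ×-homo-+ 1# m n
  +ᶻ-homo (+ m)    -[1+ n ] = ⊖-homo m (suc n)
  +ᶻ-homo -[1+ m ] (+ n)    = trans (⊖-homo n (suc m)) (+-comm _ _)
  +ᶻ-homo -[1+ m ] -[1+ n ] = begin
    - (suc (suc (m ℕ.+ n)) ⊠ 1#)         ≡⟨ cong (λ k → - (k ⊠ 1#)) (cong suc (≡.sym (ℕ.+-suc m n))) ⟩
    - ((suc m ℕ.+ suc n) ⊠ 1#)           ≈⟨ -‿cong (×-homo-+ 1# (suc m) (suc n)) ⟩
    - (suc m ⊠ 1# + suc n ⊠ 1#)          ≈⟨ sym (⁻¹-∙-comm _ _) ⟩
    - (suc m ⊠ 1#) - (suc n ⊠ 1#)        ∎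

  -◃-homo : ∀ k → ⟦ Sign.- ◃ k ⟧ᶻ ≈ - (k ⊠ 1#)
  -◃-homo zero    = sym -0#≈0#
  -◃-homo (suc k) = refl

  *ᶻ-homo : ∀ i j → ⟦ i ℤ.* j ⟧ᶻ ≈ ⟦ i ⟧ᶻ * ⟦ j ⟧ᶻ
  *ᶻ-homo (+ m) (+ n) rewrite ℤ.+◃n≡+n (m ℕ.* n) = ×1-homo-* m n
  *ᶻ-homo (+ m) -[1+ n ] = begin
    ⟦ Sign.- ◃ m ℕ.* suc n ⟧ᶻ    ≈⟨ -◃-homo (m ℕ.* suc n) ⟩
    - ((m ℕ.* suc n) ⊠ 1#)       ≈⟨ -‿cong (×1-homo-* m (suc n)) ⟩
    - (m ⊠ 1# * suc n ⊠ 1#)      ≈⟨ -‿distribʳ-* _ _ ⟩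
    m ⊠ 1# * - (suc n ⊠ 1#)      ∎
  *ᶻ-homo -[1+ m ] (+ n) = begin
    ⟦ Sign.- ◃ suc m ℕ.* n ⟧ᶻ    ≈⟨ -◃-homo (suc m ℕ.* n) ⟩
    - ((suc m ℕ.* n) ⊠ 1#)       ≈⟨ -‿cong (×1-homo-* (suc m) n) ⟩
    - (suc m ⊠ 1# * n ⊠ 1#)      ≈⟨ -‿distribˡ-* _ _ ⟩
    - (suc m ⊠ 1#) * n ⊠ 1#      ∎
  *ᶻ-homo -[1+ m ] -[1+ n ] = begin
    (suc m ℕ.* suc n) ⊠ 1#                ≈⟨ ×1-homo-* (suc m) (suc n) ⟩
    suc m ⊠ 1# * suc n ⊠ 1#               ≈⟨ sym (-‿involutive _) ⟩
    - (- (suc m ⊠ 1# * suc n ⊠ 1#))       ≈⟨ -‿cong (-‿distribˡ-* _ _) ⟩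
    - (- (suc m ⊠ 1#) * suc n ⊠ 1#)       ≈⟨ -‿distribʳ-* _ _ ⟩
    - (suc m ⊠ 1#) * - (suc n ⊠ 1#)       ∎

  -ᶻ-homo : ∀ i → ⟦ ℤ.- i ⟧ᶻ ≈ - ⟦ i ⟧ᶻ
  -ᶻ-homo (+ zero)  = sym -0#≈0#
  -ᶻ-homo (+ suc n) = refl
  -ᶻ-homo -[1+ n ]  = sym (-‿involutive _)

  -- Coefficients are taken in `ℤ` because their equality computes; over an abstract `Carrier`
  -- cancellations such as `1# - 1#` would not be recognised.
  ℤ⟶R : ℤ.+-*-rawRing -Raw-AlmostCommutative⟶ fromCommutativeRing R
  ℤ⟶R = record
    { ⟦_⟧ = ⟦_⟧ᶻ ; +-homo = +ᶻ-homo ; *-homo = *ᶻ-homo ; -‿homo = -ᶻ-homo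
    ; 0-homo = refl ; 1-homo = refl }

  ≟ᶻ-sound : ∀ i j → Maybe (⟦ i ⟧ᶻ ≈ ⟦ j ⟧ᶻ)
  ≟ᶻ-sound i j with i ℤ.≟ j
  ... | yes ≡.refl = just refl
  ... | no _       = nothing

  open RingSolver ℤ.+-*-rawRing (fromCommutativeRing R) ℤ⟶R ≟ᶻ-sound public
    using (solve; _:=_; _:+_; _:*_; _:-_; :-_; con)

-- Boolean comparisons and ranges of positions

T⇒≡ : ∀ {b} → T b → b ≡ true
T⇒≡ {true} _ = ≡.refl

≡⇒T : ∀ {b} → b ≡ true → T b
≡⇒T ≡.refl = tt

¬T⇒≡ : ∀ {b} → ¬ T b → b ≡ false
¬T⇒≡ {true}  h = ⊥-elim (h tt)
¬T⇒≡ {false} h = ≡.refl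

≡ᵇ-refl : ∀ a → (a ≡ᵇ a) ≡ true
≡ᵇ-refl a = T⇒≡ (ℕ.≡⇒≡ᵇ a a ≡.refl)

≢⇒≡ᵇ : ∀ {a b} → a ≢ b → (a ≡ᵇ b) ≡ false
≢⇒≡ᵇ {a} {b} a≢b = ¬T⇒≡ (λ t → a≢b (ℕ.≡ᵇ⇒≡ a b t))

≡ᵇ-sym : ∀ a b → (a ≡ᵇ b) ≡ (b ≡ᵇ a)
≡ᵇ-sym zero    zero    = ≡.refl
≡ᵇ-sym zero    (suc b) = ≡.refl
≡ᵇ-sym (suc a) zero    = ≡.refl
≡ᵇ-sym (suc a) (suc b) = ≡ᵇ-sym a b

<⇒<ᵇ-true : ∀ {a b} → a ℕ.< b → (a <ᵇ b) ≡ true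
<⇒<ᵇ-true a<b = T⇒≡ (ℕ.<⇒<ᵇ a<b)

≥⇒<ᵇ-false : ∀ {a b} → b ≤ a → (a <ᵇ b) ≡ false
≥⇒<ᵇ-false {a} {b} b≤a = ¬T⇒≡ (λ t → ℕ.≤⇒≯ b≤a (ℕ.<ᵇ⇒< a b t))

<ᵇ-true⇒< : ∀ {a b} → (a <ᵇ b) ≡ true → a ℕ.< b
<ᵇ-true⇒< {a} {b} eq = ℕ.<ᵇ⇒< a b (≡⇒T eq)

<ᵇ-false⇒≥ : ∀ {a b} → (a <ᵇ b) ≡ false → b ≤ a
<ᵇ-false⇒≥ {a} {b} eq = ℕ.≮⇒≥ (λ a<b → subst T eq (ℕ.<⇒<ᵇ a<b))

range-last : ∀ m → range (suc m) ≡ range m ++ (suc m ∷ [])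
range-last m = ≡.trans (cong (map suc) (≡.sym (upTo-∷ʳ m))) (map-++ suc (upTo m) (m ∷ []))

range-head : ∀ m → range (suc m) ≡ 1 ∷ map suc (range m)
range-head m = cong (λ l → 1 ∷ map suc l) (≡.sym (map-upTo suc m))

-- Signs, finite sums and finite products in an ordered field

module OrderedFieldProperties {c ℓ} (F : OrderedField c ℓ) where
  open OrderedField F
  open IntegerSolver commutativeRing
  open IsStrictTotalOrder isStrictTotalOrder using (compare; <-resp-≈) renaming (trans to <-trans; irrefl to <-irrefl)
  open Relation.Binary.Reasoning.Setoid setoid

  <-respʳ : ∀ {a b d} → b ≈ d → a < b → a < d
  <-respʳ = proj₁ <-resp-≈

  <-respˡ : ∀ {a b d} → b ≈ d → b < a → d < a
  <-respˡ = proj₂ <-resp-≈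

  pos⇒≉0 : ∀ {a} → 0# < a → ¬ (a ≈ 0#)
  pos⇒≉0 0<a a≈0 = <-irrefl (sym a≈0) 0<a

  nonneg-resp : ∀ {a b} → a ≈ b → 0# ≤F a → 0# ≤F b
  nonneg-resp eq (inj₁ h) = inj₁ (<-respʳ eq h)
  nonneg-resp eq (inj₂ h) = inj₂ (trans h eq)

  pos+nonneg : ∀ {a b} → 0# < a → 0# ≤F b → 0# < (a + b)
  pos+nonneg {a} {b} 0<a (inj₁ 0<b) = <-trans 0<b (<-respˡ (+-identityˡ b) (+-mono-< b 0<a))
  pos+nonneg 0<a (inj₂ 0≈b) = <-respʳ (trans (sym (+-identityʳ _)) (+-congˡ 0≈b)) 0<a

  nonneg+nonneg : ∀ {a b} → 0# ≤F a → 0# ≤F b → 0# ≤F (a + b)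
  nonneg+nonneg (inj₁ 0<a) 0≤b = inj₁ (pos+nonneg 0<a 0≤b)
  nonneg+nonneg (inj₂ 0≈a) 0≤b = nonneg-resp (trans (sym (+-identityˡ _)) (+-congʳ 0≈a)) 0≤b

  nonneg*nonneg : ∀ {a b} → 0# ≤F a → 0# ≤F b → 0# ≤F (a * b)
  nonneg*nonneg (inj₁ 0<a) (inj₁ 0<b) = inj₁ (*-pos 0<a 0<b)
  nonneg*nonneg (inj₂ 0≈a) _          = inj₂ (trans (sym (zeroˡ _)) (*-congʳ 0≈a))
  nonneg*nonneg (inj₁ _)   (inj₂ 0≈b) = inj₂ (trans (sym (zeroʳ _)) (*-congˡ 0≈b))

  <⇒0<- : ∀ {a b} → a < b → 0# < (b - a)
  <⇒0<- {a} {b} a<b = <-respˡ (-‿inverseʳ a) (+-mono-< (- a) a<b)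

  ≤⇒0≤- : ∀ {a b} → a ≤F b → 0# ≤F (b - a)
  ≤⇒0≤- (inj₁ a<b) = inj₁ (<⇒0<- a<b)
  ≤⇒0≤- {a} (inj₂ a≈b) = inj₂ (trans (sym (-‿inverseʳ a)) (+-congʳ a≈b))

  ⁻¹-pos : ∀ {a} → 0# < a → 0# < (a ⁻¹)
  ⁻¹-pos {a} 0<a with compare 0# (a ⁻¹)
  ... | tri< h _ _ = h
  ... | tri≈ _ h _ = ⊥-elim (pos⇒≉0 0<1 (begin
          1#         ≈⟨ sym (⁻¹-inverse a (pos⇒≉0 0<a)) ⟩
          a * a ⁻¹   ≈⟨ *-congˡ (sym h) ⟩
          a * 0#     ≈⟨ zeroʳ a ⟩
          0#         ∎))
  ... | tri> _ _ h = ⊥-elim (<-irrefl refl (<-trans 0<1 (<-respˡ (+-identityˡ 1#)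
          (<-respʳ (-‿inverseˡ 1#) (+-mono-< 1# 0<-1)))))
    where
    0<-1 : 0# < (- 1#)
    0<-1 = <-respʳ (begin
      a * (0# - a ⁻¹)  ≈⟨ solve 2 (λ a b → a :* (con (+ 0) :- b) := :- (a :* b)) refl a (a ⁻¹) ⟩
      - (a * a ⁻¹)     ≈⟨ -‿cong (⁻¹-inverse a (pos⇒≉0 0<a)) ⟩
      - 1#             ∎) (*-pos 0<a (<⇒0<- h))

  ∑ : ∀ {a} {A : Set a} → List A → (A → Carrier) → Carrier
  ∑ xs f = foldr _+_ 0# (map f xs)

  ∏ : ∀ {a} {A : Set a} → List A → (A → Carrier) → Carrier
  ∏ xs f = foldr _*_ 1# (map f xs)

  module _ {a} {A : Set a} where
    ∑-cong : ∀ (xs : List A) {f g : A → Carrier} → (∀ i → f i ≈ g i) → ∑ xs f ≈ ∑ xs g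
    ∑-cong []       eq = refl
    ∑-cong (i ∷ xs) eq = +-cong (eq i) (∑-cong xs eq)

    ∑-++ : ∀ (xs ys : List A) (f : A → Carrier) → ∑ (xs ++ ys) f ≈ ∑ xs f + ∑ ys f
    ∑-++ []       ys f = sym (+-identityˡ _)
    ∑-++ (i ∷ xs) ys f = trans (+-congˡ (∑-++ xs ys f)) (sym (+-assoc _ _ _))

    ∏-++ : ∀ (xs ys : List A) (f : A → Carrier) → ∏ (xs ++ ys) f ≈ ∏ xs f * ∏ ys f
    ∏-++ []       ys f = sym (*-identityˡ _)
    ∏-++ (i ∷ xs) ys f = trans (*-congˡ (∏-++ xs ys f)) (sym (*-assoc _ _ _))

    ∑-distrib-+ : ∀ (xs : List A) (f g : A → Carrier) → ∑ xs (λ i → f i + g i) ≈ ∑ xs f + ∑ xs g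
    ∑-distrib-+ []       f g = sym (+-identityˡ 0#)
    ∑-distrib-+ (i ∷ xs) f g = trans (+-congˡ (∑-distrib-+ xs f g))
      (solve 4 (λ a b c d → (a :+ b) :+ (c :+ d) := (a :+ c) :+ (b :+ d)) refl (f i) (g i) (∑ xs f) (∑ xs g))

    *-distribˡ-∑ : ∀ (xs : List A) d (f : A → Carrier) → d * ∑ xs f ≈ ∑ xs (λ i → d * f i)
    *-distribˡ-∑ []       d f = zeroʳ d
    *-distribˡ-∑ (i ∷ xs) d f = trans (distribˡ d (f i) _) (+-congˡ (*-distribˡ-∑ xs d f))

    ∑-zero : ∀ (xs : List A) → ∑ xs (λ _ → 0#) ≈ 0#
    ∑-zero []       = refl
    ∑-zero (i ∷ xs) = trans (+-identityˡ _) (∑-zero xs)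

  ∑-swap : ∀ {a b} {A : Set a} {B : Set b} (xs : List A) (ys : List B) (f : A → B → Carrier) →
    ∑ xs (λ i → ∑ ys (f i)) ≈ ∑ ys (λ j → ∑ xs (λ i → f i j))
  ∑-swap []       ys f = sym (∑-zero ys)
  ∑-swap (i ∷ xs) ys f = trans (+-congˡ (∑-swap xs ys f)) (sym (∑-distrib-+ ys (f i) _))

  ∑-map : ∀ {a b} {A : Set a} {B : Set b} (g : A → B) (xs : List A) (f : B → Carrier) →
    ∑ (map g xs) f ≡ ∑ xs (λ i → f (g i))
  ∑-map g xs f = cong (foldr _+_ 0#) (≡.sym (map-∘ xs))

  ∏-map : ∀ {a b} {A : Set a} {B : Set b} (g : A → B) (xs : List A) (f : B → Carrier) →
    ∏ (map g xs) f ≡ ∏ xs (λ i → f (g i))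
  ∏-map g xs f = cong (foldr _*_ 1#) (≡.sym (map-∘ xs))

  ∑-concatMap : ∀ {a b} {A : Set a} {B : Set b} (g : A → List B) (xs : List A) (f : B → Carrier) →
    ∑ (concatMap g xs) f ≈ ∑ xs (λ i → ∑ (g i) f)
  ∑-concatMap g []       f = refl
  ∑-concatMap g (i ∷ xs) f = trans (∑-++ (g i) (concatMap g xs) f) (+-congˡ (∑-concatMap g xs f))

  ∑-filterᵇ : ∀ {a} {A : Set a} (b : A → Bool) (xs : List A) (f : A → Carrier) →
    ∑ (filterᵇ b xs) f ≈ ∑ xs (λ i → if b i then f i else 0#)
  ∑-filterᵇ b []       f = refl
  ∑-filterᵇ b (i ∷ xs) f with b i
  ... | true  = +-congˡ (∑-filterᵇ b xs f)
  ... | false = trans (∑-filterᵇ b xs f) (sym (+-identityˡ _))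

  ∑-last : ∀ m f → ∑ (range (suc m)) f ≈ ∑ (range m) f + f (suc m)
  ∑-last m f = trans (reflexive (cong (λ l → ∑ l f) (range-last m))) (trans (∑-++ (range m) _ f) (+-congˡ (+-identityʳ _)))

  ∏-last : ∀ m f → ∏ (range (suc m)) f ≈ ∏ (range m) f * f (suc m)
  ∏-last m f = trans (reflexive (cong (λ l → ∏ l f) (range-last m))) (trans (∏-++ (range m) _ f) (*-congˡ (*-identityʳ _)))

  ∑-head : ∀ m f → ∑ (range (suc m)) f ≡ f 1 + ∑ (range m) (λ i → f (suc i))
  ∑-head m f = ≡.trans (cong (λ l → ∑ l f) (range-head m)) (cong (λ s → f 1 + s) (∑-map suc (range m) f))

  ∏-head : ∀ m f → ∏ (range (suc m)) f ≡ f 1 * ∏ (range m) (λ i → f (suc i))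
  ∏-head m f = ≡.trans (cong (λ l → ∏ l f) (range-head m)) (cong (λ s → f 1 * s) (∏-map suc (range m) f))

  ∑-range-cong : ∀ m {f g} → (∀ i → 1 ≤ i → i ≤ m → f i ≈ g i) → ∑ (range m) f ≈ ∑ (range m) g
  ∑-range-cong zero    eq = refl
  ∑-range-cong (suc m) {f} {g} eq = trans (∑-last m f) (trans
    (+-cong (∑-range-cong m (λ i 1≤i i≤m → eq i 1≤i (ℕ.m≤n⇒m≤1+n i≤m))) (eq (suc m) (s≤s z≤n) ℕ.≤-refl))
    (sym (∑-last m g)))

  ∏-range-cong : ∀ m {f g} → (∀ i → 1 ≤ i → i ≤ m → f i ≈ g i) → ∏ (range m) f ≈ ∏ (range m) g
  ∏-range-cong zero    eq = refl
  ∏-range-cong (suc m) {f} {g} eq = trans (∏-last m f) (trans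
    (*-cong (∏-range-cong m (λ i 1≤i i≤m → eq i 1≤i (ℕ.m≤n⇒m≤1+n i≤m))) (eq (suc m) (s≤s z≤n) ℕ.≤-refl))
    (sym (∏-last m g)))

  ∑-select : ∀ m b (f : ℕ → Carrier) → 1 ≤ b → b ≤ m → ∑ (range m) (λ a → if a ≡ᵇ b then f a else 0#) ≈ f b
  ∑-select zero    zero f () b≤m
  ∑-select (suc m) b f 1≤b b≤1+m with b ℕ.≟ suc m
  ... | yes ≡.refl = begin
    ∑ (range (suc m)) _                                          ≈⟨ ∑-last m _ ⟩
    ∑ (range m) _ + (if m ≡ᵇ m then f (suc m) else 0#)           ≈⟨ +-cong
        (trans (∑-range-cong m off-diagonal) (∑-zero (range m)))
        (reflexive (cong (λ e → if e then f (suc m) else 0#) (≡ᵇ-refl m))) ⟩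
    0# + f (suc m)                                               ≈⟨ +-identityˡ _ ⟩
    f (suc m)                                                    ∎
    where
    off-diagonal : ∀ i → 1 ≤ i → i ≤ m → (if i ≡ᵇ suc m then f i else 0#) ≈ 0#
    off-diagonal i _ i≤m = reflexive (cong (λ e → if e then f i else 0#) (≢⇒≡ᵇ (ℕ.<⇒≢ (s≤s i≤m))))
  ... | no b≢1+m = begin
    ∑ (range (suc m)) _                                          ≈⟨ ∑-last m _ ⟩
    ∑ (range m) _ + (if suc m ≡ᵇ b then f (suc m) else 0#)       ≈⟨ +-cong
        (∑-select m b f 1≤b (ℕ.≤-pred (ℕ.≤∧≢⇒< b≤1+m b≢1+m)))
        (reflexive (cong (λ e → if e then f (suc m) else 0#) (≢⇒≡ᵇ (λ eq → b≢1+m (≡.sym eq))))) ⟩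
    f b + 0#                                                     ≈⟨ +-identityʳ _ ⟩
    f b                                                          ∎

infixl 6 _⊕_

-- Sets are Boolean functions compared pointwise, so each quantity that depends on a set comes with
-- its own congruence lemma.
_⊕_ : (ℕ → Bool) → ℕ → ℕ → Bool
(U ⊕ a) c = (c ≡ᵇ a) ∨ U c

∅ : ℕ → Bool
∅ _ = false

⊕-same : ∀ U a → (U ⊕ a) a ≡ true
⊕-same U a rewrite ≡ᵇ-refl a = ≡.refl

⊕-other : ∀ U {a c} → c ≢ a → (U ⊕ a) c ≡ U c
⊕-other U c≢a rewrite ≢⇒≡ᵇ c≢a = ≡.refl

⊕-comm : ∀ U a b c → (U ⊕ a ⊕ b) c ≡ (U ⊕ b ⊕ a) c
⊕-comm U a b c with c ≡ᵇ a | c ≡ᵇ b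
... | true  | true  = ≡.refl
... | true  | false = ≡.refl
... | false | true  = ≡.refl
... | false | false = ≡.refl

⊕-cong : ∀ {U V : ℕ → Bool} a → (∀ c → U c ≡ V c) → ∀ c → (U ⊕ a) c ≡ (V ⊕ a) c
⊕-cong a eq c = cong ((c ≡ᵇ a) ∨_) (eq c)

⊕-false : ∀ U a c → (U ⊕ a) c ≡ false → c ≢ a × U c ≡ false
⊕-false U a c eq with c ℕ.≟ a
... | yes ≡.refl with ≡.trans (≡.sym (⊕-same U c)) eq
...   | ()
⊕-false U a c eq | no c≢a = c≢a , ≡.trans (≡.sym (⊕-other U c≢a)) eq

absent : (ℕ → Bool) → ℕ → ℕ
absent U zero    = 0
absent U (suc m) = if U (suc m) then absent U m else suc (absent U m)

absent-cong : ∀ {U V} m → (∀ c → c ≤ m → U c ≡ V c) → absent U m ≡ absent V m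
absent-cong zero    eq = ≡.refl
absent-cong (suc m) eq = cong₂ (λ e k → if e then k else suc k) (eq (suc m) ℕ.≤-refl)
  (absent-cong m (λ c c≤m → eq c (ℕ.m≤n⇒m≤1+n c≤m)))

⊕-below : ∀ U {a m} → m ℕ.< a → ∀ c → c ≤ m → (U ⊕ a) c ≡ U c
⊕-below U m<a c c≤m = ⊕-other U (ℕ.<⇒≢ (ℕ.≤-<-trans c≤m m<a))

absent-⊕< : ∀ U {a m} → m ℕ.< a → absent (U ⊕ a) m ≡ absent U m
absent-⊕< U {m = m} m<a = absent-cong m (⊕-below U m<a)

absent-⊕≥ : ∀ U {a} m → U a ≡ false → 1 ≤ a → a ≤ m → suc (absent (U ⊕ a) m) ≡ absent U m
absent-⊕≥ U {suc a} zero Ua 1≤a ()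
absent-⊕≥ U {a} (suc m) Ua 1≤a a≤1+m with a ℕ.≟ suc m
... | yes ≡.refl rewrite ≡ᵇ-refl m | Ua = cong suc (absent-⊕< U {suc m} {m} ℕ.≤-refl)
... | no a≢1+m rewrite ⊕-other U (λ eq → a≢1+m (≡.sym eq)) with U (suc m)
...   | true  = absent-⊕≥ U m Ua 1≤a (ℕ.≤-pred (ℕ.≤∧≢⇒< a≤1+m a≢1+m))
...   | false = cong suc (absent-⊕≥ U m Ua 1≤a (ℕ.≤-pred (ℕ.≤∧≢⇒< a≤1+m a≢1+m)))

absent-pred : ∀ U {a} → 1 ≤ a → U a ≡ false → absent U a ≡ suc (absent U (a ∸ 1))
absent-pred U {suc a} _ Ua rewrite Ua = ≡.refl

absent-∅ : ∀ m → absent ∅ m ≡ m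
absent-∅ zero    = ≡.refl
absent-∅ (suc m) = cong suc (absent-∅ m)

absent-full : ∀ U m → (∀ c → 1 ≤ c → c ≤ m → U c ≡ true) → absent U m ≡ 0
absent-full U zero    full = ≡.refl
absent-full U (suc m) full rewrite full (suc m) (s≤s z≤n) ℕ.≤-refl =
  absent-full U m (λ c 1≤c c≤m → full c 1≤c (ℕ.m≤n⇒m≤1+n c≤m))

-- w lists the elements of [n] outside U, each exactly once.
data Enumerates (n : ℕ) (U : ℕ → Bool) : List ℕ → Set where
  []  : (∀ c → 1 ≤ c → c ≤ n → U c ≡ true) → Enumerates n U []
  _∷_ : ∀ {a w} → (1 ≤ a × a ≤ n) × U a ≡ false → Enumerates n (U ⊕ a) w → Enumerates n U (a ∷ w)

Enumerates-cong : ∀ {n U V w} → (∀ c → U c ≡ V c) → Enumerates n U w → Enumerates n V w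
Enumerates-cong eq ([] full)           = [] (λ c 1≤c c≤n → ≡.trans (≡.sym (eq c)) (full c 1≤c c≤n))
Enumerates-cong eq (_∷_ {a} (r , Ua) e) = (r , ≡.trans (≡.sym (eq a)) Ua) ∷ Enumerates-cong (⊕-cong a eq) e

Enumerates-swap : ∀ {n U a b w} → Enumerates n U (a ∷ b ∷ w) → Enumerates n U (b ∷ a ∷ w)
Enumerates-swap {U = U} {a} {b} ((ra , Ua) ∷ (rb , Ub) ∷ e) with ⊕-false U a b Ub
... | b≢a , Ub′ = (rb , Ub′) ∷ (ra , ≡.trans (⊕-other U (λ eq → b≢a (≡.sym eq))) Ua) ∷ Enumerates-cong (⊕-comm U a b) e

-- Sampling weights and their change when a letter is used

module SequentialSampling {c ℓ} (F : OrderedField c ℓ)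
  (q : OrderedField.Carrier F) (x : ℕ → OrderedField.Carrier F) (n : ℕ)
  (1≤q : OrderedField._≤F_ F (OrderedField.1# F) q)
  (x-pos : ∀ i → 1 ≤ i → i ≤ n → OrderedField._<_ F (OrderedField.0# F) (x i)) where
  open OrderedField F
  open OrderedFieldProperties F
  open Tsetlin F q x n
  open IntegerSolver commutativeRing
  open Relation.Binary.Reasoning.Setoid setoid

  0<q : 0# < q
  0<q = <-respʳ (solve 1 (λ q → con (+ 1) :+ (q :- con (+ 1)) := q) refl q) (pos+nonneg 0<1 (≤⇒0≤- 1≤q))

  p : Carrier
  p = q ⁻¹

  0<p : 0# < p
  0<p = ⁻¹-pos 0<q

  qp≈1 : q * p ≈ 1#
  qp≈1 = ⁻¹-inverse q (pos⇒≉0 0<q)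

  -- Here `1≤q` gives more than `0<q`: the coefficient of `carry` in `W` is nonnegative.
  0≤1-p : 0# ≤F (1# - p)
  0≤1-p = nonneg-resp (begin
    (q - 1#) * p  ≈⟨ solve 2 (λ q p → (q :- con (+ 1)) :* p := q :* p :- p) refl q p ⟩
    q * p - p     ≈⟨ +-congʳ qp≈1 ⟩
    1# - p        ∎) (nonneg*nonneg (≤⇒0≤- 1≤q) (inj₁ 0<p))

  powℕ-pos : ∀ {a} → 0# < a → ∀ k → 0# < powℕ a k
  powℕ-pos 0<a zero    = 0<1
  powℕ-pos 0<a (suc k) = *-pos 0<a (powℕ-pos 0<a k)

  qᵏpᵏ≈1 : ∀ k → powℕ q k * powℕ p k ≈ 1#
  qᵏpᵏ≈1 zero    = *-identityˡ 1#
  qᵏpᵏ≈1 (suc k) = begin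
    (q * powℕ q k) * (p * powℕ p k)   ≈⟨ solve 4 (λ q p a b → (q :* a) :* (p :* b) := (q :* p) :* (a :* b)) refl q p (powℕ q k) (powℕ p k) ⟩
    (q * p) * (powℕ q k * powℕ p k)   ≈⟨ *-cong qp≈1 (qᵏpᵏ≈1 k) ⟩
    1# * 1#                           ≈⟨ *-identityˡ 1# ⟩
    1#                                ∎

  -- carry U m = Σ_{b ∈ U, b ≤ m} x_b q^{-#{c ∉ U, b < c ≤ m}}
  carry : (ℕ → Bool) → ℕ → Carrier
  carry U zero    = 0#
  carry U (suc m) = if U (suc m) then carry U m + x (suc m) else p * carry U m

  carry-cong : ∀ {U V} m → (∀ c → c ≤ m → U c ≡ V c) → carry U m ≡ carry V m
  carry-cong zero    eq = ≡.refl
  carry-cong (suc m) eq = cong₂ (λ e k → if e then k + x (suc m) else p * k) (eq (suc m) ℕ.≤-refl)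
    (carry-cong m (λ c c≤m → eq c (ℕ.m≤n⇒m≤1+n c≤m)))

  carry-nonneg : ∀ U m → m ≤ n → 0# ≤F carry U m
  carry-nonneg U zero    m≤n = inj₂ refl
  carry-nonneg U (suc m) m<n with U (suc m)
  ... | true  = nonneg+nonneg (carry-nonneg U m (ℕ.<⇒≤ m<n)) (inj₁ (x-pos (suc m) (s≤s z≤n) m<n))
  ... | false = nonneg*nonneg (inj₁ 0<p) (carry-nonneg U m (ℕ.<⇒≤ m<n))

  W : (ℕ → Bool) → ℕ → Carrier
  W U a = x a + (1# - p) * carry U (a ∸ 1)

  W-cong : ∀ {U V} a → (∀ c → c ≤ a ∸ 1 → U c ≡ V c) → W U a ≡ W V a
  W-cong a eq = cong (λ k → x a + (1# - p) * k) (carry-cong (a ∸ 1) eq)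

  W-pos : ∀ U a → 1 ≤ a → a ≤ n → 0# < W U a
  W-pos U a 1≤a a≤n = pos+nonneg (x-pos a 1≤a a≤n)
    (nonneg*nonneg 0≤1-p (carry-nonneg U (a ∸ 1) (ℕ.≤-trans (ℕ.m∸n≤m a 1) a≤n)))

  D : (ℕ → Bool) → Carrier
  D U = sumX - carry U n

  D-cong : ∀ {U V} → (∀ c → U c ≡ V c) → D U ≡ D V
  D-cong eq = cong (λ k → sumX - k) (carry-cong n (λ c _ → eq c))

  -- `D U` is `deficit U n` by definition; truncating at `m` makes positivity and the sum formula
  -- for `D` inductions on `m`.
  deficit : (ℕ → Bool) → ℕ → Carrier
  deficit U m = ∑ (range m) x - carry U m

  deficit-suc : ∀ U m → deficit U (suc m) ≈ deficit U m + (if U (suc m) then 0# else W U (suc m))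
  deficit-suc U m with U (suc m)
  ... | true  = trans (+-congʳ (∑-last m x)) (solve 3 (λ s y k → (s :+ y) :- (k :+ y) := (s :- k) :+ con (+ 0)) refl (∑ (range m) x) (x (suc m)) (carry U m))
  ... | false = trans (+-congʳ (∑-last m x)) (solve 4 (λ s y k p → (s :+ y) :- p :* k := (s :- k) :+ (y :+ (con (+ 1) :- p) :* k)) refl (∑ (range m) x) (x (suc m)) (carry U m) p)

  increment-nonneg : ∀ U m → m ℕ.< n → 0# ≤F (if U (suc m) then 0# else W U (suc m))
  increment-nonneg U m m<n with U (suc m)
  ... | true  = inj₂ refl
  ... | false = inj₁ (W-pos U (suc m) (s≤s z≤n) m<n)

  deficit-nonneg : ∀ U m → m ≤ n → 0# ≤F deficit U m
  deficit-nonneg U zero    m≤n = inj₂ (sym (-‿inverseʳ 0#))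
  deficit-nonneg U (suc m) m<n = nonneg-resp (sym (deficit-suc U m))
    (nonneg+nonneg (deficit-nonneg U m (ℕ.<⇒≤ m<n)) (increment-nonneg U m m<n))

  deficit-pos : ∀ U {a} m → m ≤ n → U a ≡ false → 1 ≤ a → a ≤ m → 0# < deficit U m
  deficit-pos U {suc a} zero    m≤n Ua 1≤a ()
  deficit-pos U {a}     (suc m) m<n Ua 1≤a a≤1+m with a ℕ.≟ suc m
  ... | yes ≡.refl = <-respʳ (trans (+-comm _ _) (trans (+-congˡ (reflexive (cong (λ e → if e then 0# else W U (suc m)) (≡.sym Ua)))) (sym (deficit-suc U m))))
                       (pos+nonneg (W-pos U (suc m) 1≤a m<n) (deficit-nonneg U m (ℕ.<⇒≤ m<n)))
  ... | no a≢1+m = <-respʳ (sym (deficit-suc U m))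
                     (pos+nonneg (deficit-pos U m (ℕ.<⇒≤ m<n) Ua 1≤a (ℕ.≤-pred (ℕ.≤∧≢⇒< a≤1+m a≢1+m))) (increment-nonneg U m m<n))

  D-pos : ∀ U {a} → U a ≡ false → 1 ≤ a → a ≤ n → 0# < D U
  D-pos U = deficit-pos U n ℕ.≤-refl

  ∑-W : ∀ U m → ∑ (range m) (λ a → if U a then 0# else W U a) ≈ deficit U m
  ∑-W U zero    = sym (-‿inverseʳ 0#)
  ∑-W U (suc m) = trans (∑-last m _) (trans (+-congʳ (∑-W U m)) (sym (deficit-suc U m)))

  carry-⊕< : ∀ U {a m} → m ℕ.< a → carry (U ⊕ a) m ≡ carry U m
  carry-⊕< U {m = m} m<a = carry-cong m (⊕-below U m<a)

  carry-⊕≥ : ∀ U {a} m → U a ≡ false → 1 ≤ a → a ≤ m →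
    carry (U ⊕ a) m ≈ carry U m + W U a * (powℕ p (absent U m) * powℕ q (absent U a))
  carry-⊕≥ U {suc a} zero Ua 1≤a ()
  carry-⊕≥ U {a} (suc m) Ua 1≤a a≤1+m with a ℕ.≟ suc m
  ... | yes ≡.refl rewrite ≡ᵇ-refl m | Ua | carry-⊕< U {suc m} {m} ℕ.≤-refl = sym (begin
    p * k + (x (suc m) + (1# - p) * k) * (powℕ p (suc z) * powℕ q (suc z))
      ≈⟨ +-congˡ (*-congˡ (trans (*-comm _ _) (qᵏpᵏ≈1 (suc z)))) ⟩
    p * k + (x (suc m) + (1# - p) * k) * 1#
      ≈⟨ solve 3 (λ p k y → p :* k :+ (y :+ (con (+ 1) :- p) :* k) :* con (+ 1) := k :+ y) refl p k (x (suc m)) ⟩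
    k + x (suc m) ∎)
    where
    k = carry U m
    z = absent U m
  ... | no a≢1+m rewrite ⊕-other U (λ eq → a≢1+m (≡.sym eq)) with U (suc m)
  ...   | true  = trans (+-congʳ (carry-⊕≥ U m Ua 1≤a (ℕ.≤-pred (ℕ.≤∧≢⇒< a≤1+m a≢1+m))))
    (solve 3 (λ k w y → (k :+ w) :+ y := (k :+ y) :+ w) refl (carry U m) _ (x (suc m)))
  ...   | false = trans (*-congˡ (carry-⊕≥ U m Ua 1≤a (ℕ.≤-pred (ℕ.≤∧≢⇒< a≤1+m a≢1+m))))
    (solve 5 (λ p k w y z → p :* (k :+ w :* (y :* z)) := p :* k :+ w :* ((p :* y) :* z)) refl p (carry U m) (W U a) (powℕ p (absent U m)) (powℕ q (absent U a)))

  W-⊕≥ : ∀ U {a b} → 1 ≤ b → b ≤ a → W (U ⊕ a) b ≡ W U b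
  W-⊕≥ U {b = suc b} 1≤b b<a = W-cong (suc b) (⊕-below U b<a)

  W-⊕< : ∀ U {a b} → U a ≡ false → 1 ≤ a → a ℕ.< b →
    W (U ⊕ a) b ≈ W U b + (1# - p) * (W U a * (powℕ p (absent U (b ∸ 1)) * powℕ q (absent U a)))
  W-⊕< U {a} {suc b} Ua 1≤a (s≤s a≤b) = trans (+-congˡ (*-congˡ (carry-⊕≥ U b Ua 1≤a a≤b)))
    (solve 4 (λ y d k w → y :+ d :* (k :+ w) := (y :+ d :* k) :+ d :* w) refl _ _ _ _)

  γ : (ℕ → Bool) → ℕ → Carrier
  γ U a = powℕ q (absent U n) * powℕ p (absent U a)

  -- By `carry-⊕≥` at `n`, using `a` lowers `D` by `W U a` divided by `γ U a`.
  γD : ∀ U {a} → U a ≡ false → 1 ≤ a → a ≤ n → γ U a * D U ≈ γ U a * D (U ⊕ a) + W U a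
  γD U {a} Ua 1≤a a≤n = sym (begin
    γ U a * (sumX - carry (U ⊕ a) n) + W U a
      ≈⟨ +-congʳ (*-congˡ (+-congˡ (-‿cong (carry-⊕≥ U n Ua 1≤a a≤n)))) ⟩
    (Q * pa) * (sumX - (k + W U a * (P′ * qa))) + W U a
      ≈⟨ solve 7 (λ Q pa s k w P′ qa → (Q :* pa) :* (s :- (k :+ w :* (P′ :* qa))) :+ w
                   := (Q :* pa) :* (s :- k) :+ w :* (con (+ 1) :- (Q :* P′) :* (qa :* pa))) refl Q pa sumX k (W U a) P′ qa ⟩
    (Q * pa) * (sumX - k) + W U a * (1# - (Q * P′) * (qa * pa))
      ≈⟨ +-congˡ (*-congˡ (+-congˡ (-‿cong (*-cong (qᵏpᵏ≈1 (absent U n)) (qᵏpᵏ≈1 (absent U a)))))) ⟩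
    (Q * pa) * (sumX - k) + W U a * (1# - 1# * 1#)
      ≈⟨ solve 2 (λ g w → g :+ w :* (con (+ 1) :- con (+ 1) :* con (+ 1)) := g) refl _ (W U a) ⟩
    γ U a * D U ∎)
    where
    Q = powℕ q (absent U n)
    P′ = powℕ p (absent U n)
    qa = powℕ q (absent U a)
    pa = powℕ p (absent U a)
    k = carry U n

  -- The letter `b` is in both counts that make up `γ`, so a factor `q * p` cancels; in `γ-⊕>` it is
  -- only in the count up to `n`, and a factor `q` is lost.
  γ-⊕< : ∀ U {a b} → U b ≡ false → 1 ≤ b → b ≤ a → a ≤ n → γ (U ⊕ b) a ≈ γ U a
  γ-⊕< U {a} {b} Ub 1≤b b≤a a≤n
    rewrite ≡.sym (absent-⊕≥ U n Ub 1≤b (ℕ.≤-trans b≤a a≤n)) | ≡.sym (absent-⊕≥ U a Ub 1≤b b≤a) = sym (begin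
    (q * Q) * (p * pa)   ≈⟨ solve 4 (λ q Q p pa → (q :* Q) :* (p :* pa) := (q :* p) :* (Q :* pa)) refl q Q p pa ⟩
    (q * p) * (Q * pa)   ≈⟨ *-congʳ qp≈1 ⟩
    1# * (Q * pa)        ≈⟨ *-identityˡ _ ⟩
    Q * pa               ∎)
    where
    Q = powℕ q (absent (U ⊕ b) n)
    pa = powℕ p (absent (U ⊕ b) a)

  γ-⊕> : ∀ U {a b} → U b ≡ false → 1 ≤ b → b ≤ n → a ℕ.< b → q * γ (U ⊕ b) a ≈ γ U a
  γ-⊕> U {a} {b} Ub 1≤b b≤n a<b
    rewrite ≡.sym (absent-⊕≥ U n Ub 1≤b b≤n) | absent-⊕< U a<b = sym (*-assoc _ _ _)

  P : (ℕ → Bool) → ℕ → Carrier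
  P U a = W U a * (D U) ⁻¹

  -- The probability of drawing the letters of the word in this order when `U` is already used.
  R : (ℕ → Bool) → List ℕ → Carrier
  R U []      = 1#
  R U (a ∷ w) = P U a * R (U ⊕ a) w

  R-cong : ∀ {U V} w → (∀ c → U c ≡ V c) → R U w ≡ R V w
  R-cong []      eq = ≡.refl
  R-cong (a ∷ w) eq = cong₂ _*_ (cong₂ (λ s t → s * t ⁻¹) (W-cong a (λ c _ → eq c)) (D-cong eq)) (R-cong w (⊕-cong a eq))

-- Hecke action on row vectors and the re-insertion formula

module HeckeAction {c ℓ} (F : OrderedField c ℓ)
  (q : OrderedField.Carrier F) (x : ℕ → OrderedField.Carrier F) (n : ℕ)
  (1≤q : OrderedField._≤F_ F (OrderedField.1# F) q)
  (x-pos : ∀ i → 1 ≤ i → i ≤ n → OrderedField._<_ F (OrderedField.0# F) (x i)) where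
  open OrderedField F
  open OrderedFieldProperties F
  open Tsetlin F q x n
  open IntegerSolver commutativeRing
  open Relation.Binary.Reasoning.Setoid setoid
  open SequentialSampling F q x n 1≤q x-pos

  infix 8 _▷_

  -- Row vectors f acted on by T_i: f ▷ i = f · T_i.
  _▷_ : (List ℕ → Carrier) → ℕ → List ℕ → Carrier
  (f ▷ i) σ = if at σ (suc i) <ᵇ at σ i
              then f (swapAt i σ)
              else q * f (swapAt i σ) + (q - 1#) * f σ

  -- horner k j f = Σ_{i=0}^{k} f · T_{j+i} T_{j+i-1} ⋯ T_{j+1}
  horner : ℕ → ℕ → (List ℕ → Carrier) → List ℕ → Carrier
  horner zero    j f σ = f σ
  horner (suc k) j f σ = f σ + (horner k (suc j) f ▷ suc j) σ

  ▷-cong : ∀ {f g} i → (∀ σ → f σ ≈ g σ) → ∀ σ → (f ▷ i) σ ≈ (g ▷ i) σ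
  ▷-cong i eq σ with at σ (suc i) <ᵇ at σ i
  ... | true  = eq _
  ... | false = +-cong (*-congˡ (eq _)) (*-congˡ (eq _))

  ▷-+ : ∀ f g i σ → ((λ τ → f τ + g τ) ▷ i) σ ≈ (f ▷ i) σ + (g ▷ i) σ
  ▷-+ f g i σ with at σ (suc i) <ᵇ at σ i
  ... | true  = refl
  ... | false = solve 5 (λ q f g f′ g′ → q :* (f :+ g) :+ (q :- con (+ 1)) :* (f′ :+ g′)
      := (q :* f :+ (q :- con (+ 1)) :* f′) :+ (q :* g :+ (q :- con (+ 1)) :* g′)) refl q _ _ _ _

  ▷-* : ∀ d f i σ → ((λ τ → d * f τ) ▷ i) σ ≈ d * (f ▷ i) σ
  ▷-* d f i σ with at σ (suc i) <ᵇ at σ i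
  ... | true  = refl
  ... | false = solve 4 (λ q d f f′ → q :* (d :* f) :+ (q :- con (+ 1)) :* (d :* f′)
      := d :* (q :* f :+ (q :- con (+ 1)) :* f′)) refl q d _ _

  horner-* : ∀ k j d f σ → horner k j (λ τ → d * f τ) σ ≈ d * horner k j f σ
  horner-* zero    j d f σ = refl
  horner-* (suc k) j d f σ = begin
    d * f σ + (horner k (suc j) (λ τ → d * f τ) ▷ suc j) σ   ≈⟨ +-congˡ (▷-cong (suc j) (horner-* k (suc j) d f) σ) ⟩
    d * f σ + ((λ τ → d * horner k (suc j) f τ) ▷ suc j) σ   ≈⟨ +-congˡ (▷-* d (horner k (suc j) f) (suc j) σ) ⟩
    d * f σ + d * (horner k (suc j) f ▷ suc j) σ             ≈⟨ distribˡ d _ _ ⟨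
    d * horner (suc k) j f σ                                 ∎

  -- All generators involved have index at least 2, so they neither move nor compare the first
  -- letter. This lets the induction pass to the tail.
  horner-∷ : ∀ k j f a w → horner k (suc j) f (a ∷ w) ≡ horner k j (λ v → f (a ∷ v)) w
  horner-∷ zero    j f a w = ≡.refl
  horner-∷ (suc k) j f a w = cong₂ (λ s t → f (a ∷ w) +
      (if at w (suc (suc j)) <ᵇ at w (suc j) then s else q * s + (q - 1#) * t))
    (horner-∷ k (suc j) f a (swapAt (suc j) w)) (horner-∷ k (suc j) f a w)

  -- The hypothesis `g * Δ ≈ g * Δ′ + w`, divided by `Δ * Δ′`.
  insertion-identity : ∀ {Δ Δ′ w g i i′} → g * Δ ≈ g * Δ′ + w → Δ * i ≈ 1# → Δ′ * i′ ≈ 1# →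
    w * i * i′ + g * i ≈ g * i′
  insertion-identity {Δ} {Δ′} {w} {g} {i} {i′} eq Δi Δ′i′ = begin
    w * i * i′ + g * i                   ≈⟨ +-congˡ (trans (sym (*-identityʳ _)) (*-congˡ (sym Δ′i′))) ⟩
    w * i * i′ + g * i * (Δ′ * i′)       ≈⟨ solve 5 (λ w i i′ g Δ′ → w :* i :* i′ :+ g :* i :* (Δ′ :* i′) := (g :* Δ′ :+ w) :* (i :* i′)) refl w i i′ g Δ′ ⟩
    (g * Δ′ + w) * (i * i′)              ≈⟨ *-congʳ (sym eq) ⟩
    g * Δ * (i * i′)                     ≈⟨ solve 4 (λ g Δ i i′ → g :* Δ :* (i :* i′) := g :* i′ :* (Δ :* i)) refl g Δ i i′ ⟩
    g * i′ * (Δ * i)                     ≈⟨ trans (*-congˡ Δi) (*-identityʳ _) ⟩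
    g * i′                               ∎

  module _ (U : ℕ → Bool) {a b} (Ua : U a ≡ false) (Ub : U b ≡ false) (Uab : (U ⊕ a) b ≡ false)
    (1≤a : 1 ≤ a) (a≤n : a ≤ n) (1≤b : 1 ≤ b) (b≤n : b ≤ n) where
    private
      i  = (D U) ⁻¹
      i′ = (D (U ⊕ a)) ⁻¹
      Γ  = γ U a

    insertion-ratio : W U a * i * i′ + Γ * i ≈ Γ * i′
    insertion-ratio = insertion-identity (γD U Ua 1≤a a≤n) (⁻¹-inverse _ (pos⇒≉0 (D-pos U Ua 1≤a a≤n)))
          (⁻¹-inverse _ (pos⇒≉0 (D-pos (U ⊕ a) Uab 1≤b b≤n)))

    step-descent : ∀ r → b ℕ.< a →
      P U a * (P (U ⊕ a) b * r) + P U b * (γ (U ⊕ b) a * r) ≈ Γ * (P (U ⊕ a) b * r)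
    step-descent r b<a rewrite W-⊕≥ U {a} {b} 1≤b (ℕ.<⇒≤ b<a) = begin
      W U a * i * (W U b * i′ * r) + W U b * i * (γ (U ⊕ b) a * r)
        ≈⟨ +-congˡ (*-congˡ (*-congʳ (γ-⊕< U Ub 1≤b (ℕ.<⇒≤ b<a) a≤n))) ⟩
      W U a * i * (W U b * i′ * r) + W U b * i * (Γ * r)
        ≈⟨ solve 6 (λ wa wb i i′ g r → wa :* i :* (wb :* i′ :* r) :+ wb :* i :* (g :* r) := (wa :* i :* i′ :+ g :* i) :* (wb :* r)) refl (W U a) (W U b) i i′ Γ r ⟩
      (W U a * i * i′ + Γ * i) * (W U b * r)   ≈⟨ *-congʳ insertion-ratio ⟩
      Γ * i′ * (W U b * r)                     ≈⟨ solve 4 (λ g i′ wb r → g :* i′ :* (wb :* r) := g :* (wb :* i′ :* r)) refl Γ i′ (W U b) r ⟩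
      Γ * (W U b * i′ * r)                     ∎

    -- The diagonal Hecke term pays for the change of `W` at `b` caused by using `a`. The
    -- coefficients agree because `(q - 1) * p` is `1 - p`; that factor `p` comes from `b` itself,
    -- which is counted by `absent U b` but not by `absent U (b ∸ 1)`.
    W-ascent : a ℕ.< b → (q - 1#) * γ (U ⊕ a) b * W U a ≈ Γ * (W (U ⊕ a) b - W U b)
    W-ascent a<b = begin
      (q - 1#) * γ (U ⊕ a) b * W U a
        ≈⟨ *-congʳ (*-congˡ (γ-⊕< U Ua 1≤a (ℕ.<⇒≤ a<b) b≤n)) ⟩
      (q - 1#) * (Q * powℕ p (absent U b)) * W U a
        ≡⟨ cong (λ k → (q - 1#) * (Q * powℕ p k) * W U a) (absent-pred U 1≤b Ub) ⟩
      (q - 1#) * (Q * (p * y)) * W U a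
        ≈⟨ solve 5 (λ q Q p y w → (q :- con (+ 1)) :* (Q :* (p :* y)) :* w := (q :* p :- p) :* (Q :* y :* w)) refl q Q p y (W U a) ⟩
      (q * p - p) * (Q * y * W U a)
        ≈⟨ *-congʳ (+-congʳ qp≈1) ⟩
      (1# - p) * (Q * y * W U a)
        -- The inserted unit provides `pa` for `Γ` and `qa` for the increment in `W-⊕<`.
        ≈⟨ trans (sym (*-identityʳ _)) (*-congˡ (sym (qᵏpᵏ≈1 (absent U a)))) ⟩
      (1# - p) * (Q * y * W U a) * (qa * pa)
        ≈⟨ solve 7 (λ p Q y w qa pa wb → (con (+ 1) :- p) :* (Q :* y :* w) :* (qa :* pa)
                 := (Q :* pa) :* ((wb :+ (con (+ 1) :- p) :* (w :* (y :* qa))) :- wb)) refl p Q y (W U a) qa pa (W U b) ⟩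
      (Q * pa) * ((W U b + (1# - p) * (W U a * (y * qa))) - W U b)
        ≈⟨ *-congˡ (+-congʳ (sym (W-⊕< U Ua 1≤a a<b))) ⟩
      Γ * (W (U ⊕ a) b - W U b) ∎
      where
      Q = powℕ q (absent U n)
      y = powℕ p (absent U (b ∸ 1))
      qa = powℕ q (absent U a)
      pa = powℕ p (absent U a)

    -- The factor `q` restores the letter `b` that `γ (U ⊕ b) a` no longer counts, and the diagonal
    -- term turns `W U b` into `W (U ⊕ a) b`. What is left has the shape of the descent case.
    step-ascent : ∀ r → a ℕ.< b →
      P U a * (P (U ⊕ a) b * r) + (q * (P U b * (γ (U ⊕ b) a * r)) + (q - 1#) * (P U a * (γ (U ⊕ a) b * r)))
        ≈ Γ * (P (U ⊕ a) b * r)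
    step-ascent r a<b = begin
      W U a * i * (wb′ * i′ * r) + (q * (W U b * i * (γ (U ⊕ b) a * r)) + (q - 1#) * (W U a * i * (γ (U ⊕ a) b * r)))
        ≈⟨ solve 9 (λ wa wb wb′ i i′ q γ₁ γ₂ r →
             wa :* i :* (wb′ :* i′ :* r) :+ (q :* (wb :* i :* (γ₁ :* r)) :+ (q :- con (+ 1)) :* (wa :* i :* (γ₂ :* r)))
             := wa :* i :* (wb′ :* i′ :* r) :+ ((q :* γ₁) :* wb :+ (q :- con (+ 1)) :* γ₂ :* wa) :* (i :* r))
             refl (W U a) (W U b) wb′ i i′ q (γ (U ⊕ b) a) (γ (U ⊕ a) b) r ⟩
      W U a * i * (wb′ * i′ * r) + ((q * γ (U ⊕ b) a) * W U b + (q - 1#) * γ (U ⊕ a) b * W U a) * (i * r)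
        ≈⟨ +-congˡ (*-congʳ (+-cong (*-congʳ (γ-⊕> U Ub 1≤b b≤n a<b)) (W-ascent a<b))) ⟩
      W U a * i * (wb′ * i′ * r) + (Γ * W U b + Γ * (wb′ - W U b)) * (i * r)
        ≈⟨ solve 7 (λ wa wb wb′ i i′ g r → wa :* i :* (wb′ :* i′ :* r) :+ (g :* wb :+ g :* (wb′ :- wb)) :* (i :* r)
             := (wa :* i :* i′ :+ g :* i) :* (wb′ :* r)) refl (W U a) (W U b) wb′ i i′ Γ r ⟩
      (W U a * i * i′ + Γ * i) * (wb′ * r)   ≈⟨ *-congʳ insertion-ratio ⟩
      Γ * i′ * (wb′ * r)                     ≈⟨ solve 4 (λ g i′ wb r → g :* i′ :* (wb :* r) := g :* (wb :* i′ :* r)) refl Γ i′ wb′ r ⟩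
      Γ * (wb′ * i′ * r)                     ∎
      where wb′ = W (U ⊕ a) b

  deficit-full : ∀ U → (∀ c → 1 ≤ c → c ≤ n → U c ≡ true) → D U ≈ 0#
  deficit-full U full = trans (sym (∑-W U n)) (trans (∑-range-cong n
    (λ a 1≤a a≤n → reflexive (cong (λ e → if e then 0# else W U a) (full a 1≤a a≤n)))) (∑-zero (range n)))

  absent-last : ∀ {U a} → Enumerates n U (a ∷ []) → ∀ m → a ≤ m → m ≤ n → absent U m ≡ 1
  absent-last {U} {a} (((1≤a , _) , Ua) ∷ [] full) m a≤m m≤n = ≡.trans (≡.sym (absent-⊕≥ U m Ua 1≤a a≤m))
    (cong suc (absent-full (U ⊕ a) m (λ c 1≤c c≤m → full c 1≤c (ℕ.≤-trans c≤m m≤n))))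

  γ-last : ∀ {U a} → Enumerates n U (a ∷ []) → γ U a ≈ 1#
  γ-last {a = a} e@(((_ , a≤n) , _) ∷ _) rewrite absent-last e a ℕ.≤-refl a≤n | absent-last e n a≤n ℕ.≤-refl = qᵏpᵏ≈1 1

  -- A single remaining letter is drawn with certainty: `γ U a` is 1 and `D (U ⊕ a)` is 0, so `γD`
  -- reduces to `D U ≈ W U a`.
  P-last : ∀ {U a} → Enumerates n U (a ∷ []) → P U a ≈ 1#
  P-last {U} {a} e@(((1≤a , a≤n) , Ua) ∷ [] full) =
    trans (*-congʳ (sym D≈W)) (⁻¹-inverse _ (pos⇒≉0 (D-pos U Ua 1≤a a≤n)))
    where
    D≈W : D U ≈ W U a
    D≈W = begin
      D U                            ≈⟨ trans (sym (*-identityˡ _)) (*-congʳ (sym (γ-last e))) ⟩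
      γ U a * D U                    ≈⟨ γD U Ua 1≤a a≤n ⟩
      γ U a * D (U ⊕ a) + W U a      ≈⟨ +-congʳ (trans (*-congˡ (deficit-full (U ⊕ a) full)) (zeroʳ _)) ⟩
      0# + W U a                     ≈⟨ +-identityˡ _ ⟩
      W U a                          ∎

  -- Summing over the ways of re-inserting a into w removes a from the sampling.
  horner-R : ∀ w a U → Enumerates n U (a ∷ w) → horner (length w) 0 (R U) (a ∷ w) ≈ γ U a * R (U ⊕ a) w
  horner-R [] a U e = *-congʳ (trans (P-last e) (sym (γ-last e)))
  horner-R (b ∷ w) a U e@(((1≤a , a≤n) , Ua) ∷ ((1≤b , b≤n) , Uab) ∷ _) with Enumerates-swap e
  ... | e′@((_ , Ub) ∷ _) = trans (+-congˡ move-past-b) last-step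
    where
    r = R (U ⊕ a ⊕ b) w

    recurse : ∀ {c d} → Enumerates n U (c ∷ d ∷ w) → horner (length w) 1 (R U) (c ∷ d ∷ w) ≈ P U c * (γ (U ⊕ c) d * R (U ⊕ c ⊕ d) w)
    recurse {c} {d} (_ ∷ e″) = begin
      horner (length w) 1 (R U) (c ∷ d ∷ w)                         ≡⟨ horner-∷ (length w) 0 (R U) c (d ∷ w) ⟩
      horner (length w) 0 (λ v → P U c * R (U ⊕ c) v) (d ∷ w)       ≈⟨ horner-* (length w) 0 (P U c) _ (d ∷ w) ⟩
      P U c * horner (length w) 0 (R (U ⊕ c)) (d ∷ w)               ≈⟨ *-congˡ (horner-R w d (U ⊕ c) e″) ⟩
      P U c * (γ (U ⊕ c) d * R (U ⊕ c ⊕ d) w)                       ∎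

    -- Both orders of drawing `a` and `b` leave the same set used, hence the same tail weight `r`.
    recurse-b : horner (length w) 1 (R U) (b ∷ a ∷ w) ≈ P U b * (γ (U ⊕ b) a * r)
    recurse-b = trans (recurse e′) (*-congˡ (*-congˡ (reflexive (R-cong w (⊕-comm U b a)))))

    -- The first Hecke term with the recursive values filled in; naming it lets the two following
    -- facts branch separately on the same comparison.
    new : Carrier
    new = if b <ᵇ a then P U b * (γ (U ⊕ b) a * r)
          else q * (P U b * (γ (U ⊕ b) a * r)) + (q - 1#) * (P U a * (γ (U ⊕ a) b * r))

    move-past-b : (horner (length w) 1 (R U) ▷ 1) (a ∷ b ∷ w) ≈ new
    move-past-b with b <ᵇ a
    ... | true  = recurse-b
    ... | false = +-cong (*-congˡ recurse-b) (*-congˡ (recurse e))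

    last-step : R U (a ∷ b ∷ w) + new ≈ γ U a * R (U ⊕ a) (b ∷ w)
    last-step with b <ᵇ a in eq
    ... | true  = step-descent U Ua Ub Uab 1≤a a≤n 1≤b b≤n r (<ᵇ-true⇒< eq)
    ... | false = step-ascent U Ua Ub Uab 1≤a a≤n 1≤b b≤n r
                    (ℕ.≤∧≢⇒< (<ᵇ-false⇒≥ eq) (λ a≡b → proj₁ (⊕-false U a b Uab) (≡.sym a≡b)))

-- Words, adjacent swaps and membership in the symmetric group

Word : ℕ → ℕ → List ℕ → Set
Word m k w = length w ≡ k × All (λ a → 1 ≤ a × a ≤ m) w

anyᵇ-swapAt : ∀ (b : ℕ → Bool) i w → anyᵇ b (swapAt i w) ≡ anyᵇ b w
anyᵇ-swapAt b zero          w           = ≡.refl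
anyᵇ-swapAt b (suc zero)    []          = ≡.refl
anyᵇ-swapAt b (suc zero)    (c ∷ [])    = ≡.refl
anyᵇ-swapAt b (suc zero)    (c ∷ d ∷ w) with b c | b d
... | true  | true  = ≡.refl
... | true  | false = ≡.refl
... | false | true  = ≡.refl
... | false | false = ≡.refl
anyᵇ-swapAt b (suc (suc i)) []          = ≡.refl
anyᵇ-swapAt b (suc (suc i)) (c ∷ w)     = cong (b c ∨_) (anyᵇ-swapAt b (suc i) w)

distinct-swapAt : ∀ i w → distinct (swapAt i w) ≡ distinct w
distinct-swapAt zero          w           = ≡.refl
distinct-swapAt (suc zero)    []          = ≡.refl
distinct-swapAt (suc zero)    (c ∷ [])    = ≡.refl
distinct-swapAt (suc zero)    (c ∷ d ∷ w) rewrite ≡ᵇ-sym d c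
  with c ≡ᵇ d | anyᵇ (λ b → c ≡ᵇ b) w | anyᵇ (λ b → d ≡ᵇ b) w
... | true  | true  | true  = ≡.refl
... | true  | true  | false = ≡.refl
... | true  | false | true  = ≡.refl
... | true  | false | false = ≡.refl
... | false | true  | true  = ≡.refl
... | false | true  | false = ≡.refl
... | false | false | true  = ≡.refl
... | false | false | false = ≡.refl
distinct-swapAt (suc (suc i)) []          = ≡.refl
distinct-swapAt (suc (suc i)) (c ∷ w)     =
  cong₂ (λ s t → not s ∧ t) (anyᵇ-swapAt (λ b → c ≡ᵇ b) (suc i) w) (distinct-swapAt (suc i) w)

swapAt-involutive : ∀ i w → swapAt i (swapAt i w) ≡ w
swapAt-involutive zero          w           = ≡.refl
swapAt-involutive (suc zero)    []          = ≡.refl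
swapAt-involutive (suc zero)    (c ∷ [])    = ≡.refl
swapAt-involutive (suc zero)    (c ∷ d ∷ w) = ≡.refl
swapAt-involutive (suc (suc i)) []          = ≡.refl
swapAt-involutive (suc (suc i)) (c ∷ w)     = cong (c ∷_) (swapAt-involutive (suc i) w)

at-swapAt : ∀ i w → 1 ≤ i → i ℕ.< length w →
  at (swapAt i w) i ≡ at w (suc i) × at (swapAt i w) (suc i) ≡ at w i
at-swapAt (suc zero)    (c ∷ [])    _ (s≤s ())
at-swapAt (suc zero)    (c ∷ d ∷ w) _ _         = ≡.refl , ≡.refl
at-swapAt (suc (suc i)) (c ∷ w)     _ (s≤s i<k) = at-swapAt (suc i) w (s≤s z≤n) i<k

∧-true : ∀ {a b} → a ∧ b ≡ true → a ≡ true × b ≡ true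
∧-true {true}  eq = ≡.refl , eq
∧-true {false} ()

not-true : ∀ {a} → not a ≡ true → a ≡ false
not-true {true}  ()
not-true {false} _ = ≡.refl

∨-false : ∀ {a b} → a ∨ b ≡ false → a ≡ false × b ≡ false
∨-false {true}  ()
∨-false {false} eq = ≡.refl , eq

≡ᵇ-false⇒≢ : ∀ {a b} → (a ≡ᵇ b) ≡ false → a ≢ b
≡ᵇ-false⇒≢ {a} eq ≡.refl with ≡.trans (≡.sym (≡ᵇ-refl a)) eq
... | ()

distinct⇒adjacent-≢ : ∀ i w → 1 ≤ i → i ℕ.< length w → distinct w ≡ true → at w i ≢ at w (suc i)
distinct⇒adjacent-≢ (suc zero)    (c ∷ [])    _ (s≤s ()) _
distinct⇒adjacent-≢ (suc zero)    (c ∷ d ∷ w) _ _ dw =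
  ≡ᵇ-false⇒≢ (proj₁ (∨-false (not-true {(c ≡ᵇ d) ∨ anyᵇ (λ b → c ≡ᵇ b) w} (proj₁ (∧-true dw)))))
distinct⇒adjacent-≢ (suc (suc i)) (c ∷ w)     _ (s≤s i<k) dw =
  distinct⇒adjacent-≢ (suc i) w (s≤s z≤n) i<k (proj₂ (∧-true dw))

<ᵇ-flip : ∀ {a b} → a ≢ b → (a <ᵇ b) ≡ not (b <ᵇ a)
<ᵇ-flip {a} {b} a≢b with b <ᵇ a in eq
... | true  = ≥⇒<ᵇ-false {a} {b} (ℕ.<⇒≤ (<ᵇ-true⇒< {b} {a} eq))
... | false = <⇒<ᵇ-true {a} {b} (ℕ.≤∧≢⇒< (<ᵇ-false⇒≥ {b} {a} eq) a≢b)

∈-range : ∀ {m a} → a ∈ range m → 1 ≤ a × a ≤ m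
∈-range {m} a∈ with ∈-map⁻ suc a∈
... | i , i∈ , ≡.refl = s≤s z≤n , ∈-upTo⁻ i∈

∈-words : ∀ m k {w} → w ∈ words m k → Word m k w
∈-words m zero    (here ≡.refl) = ≡.refl , []
∈-words m (suc k) {w} w∈ with find (∈-concatMap⁻ (λ v → map (λ a → a ∷ v) (range m)) {xs = words m k} w∈)
... | v , v∈ , h with ∈-map⁻ (λ a → a ∷ v) h
...   | a , a∈ , ≡.refl = cong suc (proj₁ (∈-words m k v∈)) , ∈-range a∈ ∷ proj₂ (∈-words m k v∈)

∈-Sn : ∀ {n π} → π ∈ Sn n → Word n n π × distinct π ≡ true
∈-Sn {n} π∈ with ∈-filter⁻ (λ w → T? (distinct w)) {xs = words n n} π∈
... | π∈w , d = ∈-words n n π∈w , T⇒≡ d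

-- Sums over words and over permutations

module WordSums {c ℓ} (F : OrderedField c ℓ) (m : ℕ) where
  open OrderedField F
  open OrderedFieldProperties F
  open Relation.Binary.Reasoning.Setoid setoid

  ∑-words-suc : ∀ k (h : List ℕ → Carrier) →
    ∑ (words m (suc k)) h ≈ ∑ (words m k) (λ w → ∑ (range m) (λ a → h (a ∷ w)))
  ∑-words-suc k h = trans (∑-concatMap (λ w → map (λ a → a ∷ w) (range m)) (words m k) h)
    (∑-cong (words m k) (λ w → reflexive (∑-map (λ a → a ∷ w) (range m) h)))

  ∑-words-head : ∀ k (h : List ℕ → Carrier) →
    ∑ (words m (suc k)) h ≈ ∑ (range m) (λ a → ∑ (words m k) (λ w → h (a ∷ w)))
  ∑-words-head k h = trans (∑-words-suc k h) (∑-swap (words m k) (range m) (λ w a → h (a ∷ w)))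

  ∑-words-cong : ∀ k {f g : List ℕ → Carrier} → (∀ w → Word m k w → f w ≈ g w) →
    ∑ (words m k) f ≈ ∑ (words m k) g
  ∑-words-cong zero    eq = +-congʳ (eq [] (≡.refl , []))
  ∑-words-cong (suc k) {f} {g} eq = trans (∑-words-suc k f) (trans
    (∑-words-cong k (λ w ww → ∑-range-cong m (λ a 1≤a a≤m → eq (a ∷ w) (cong suc (proj₁ ww) , (1≤a , a≤m) ∷ proj₂ ww))))
    (sym (∑-words-suc k g)))

  -- Over all words an adjacent swap merely exchanges two nested sums. For this reason sums over
  -- `Sn` are written as sums over words with distinctness as an indicator, and no rearrangement of
  -- the list `Sn` has to be tracked.
  ∑-words-swapAt : ∀ i k (h : List ℕ → Carrier) → 1 ≤ i → i ℕ.< k →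
    ∑ (words m k) (λ w → h (swapAt i w)) ≈ ∑ (words m k) h
  ∑-words-swapAt (suc zero) (suc zero) h _ (s≤s ())
  ∑-words-swapAt (suc zero) (suc (suc k)) h _ _ = begin
    ∑ (words m (suc (suc k))) (λ w → h (swapAt 1 w))                              ≈⟨ expand (λ w → h (swapAt 1 w)) ⟩
    ∑ (words m k) (λ w → ∑ (range m) (λ b → ∑ (range m) (λ a → h (b ∷ a ∷ w))))    ≈⟨ ∑-cong (words m k) (λ w → ∑-swap (range m) (range m) _) ⟩
    ∑ (words m k) (λ w → ∑ (range m) (λ a → ∑ (range m) (λ b → h (b ∷ a ∷ w))))    ≈⟨ expand h ⟨
    ∑ (words m (suc (suc k))) h                                                   ∎
    where
    expand : ∀ (h : List ℕ → Carrier) → ∑ (words m (suc (suc k))) h ≈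
      ∑ (words m k) (λ w → ∑ (range m) (λ b → ∑ (range m) (λ a → h (a ∷ b ∷ w))))
    expand h = trans (∑-words-suc (suc k) h) (∑-words-suc k (λ w → ∑ (range m) (λ a → h (a ∷ w))))
  ∑-words-swapAt (suc (suc i)) (suc k) h _ (s≤s i<k) = trans (∑-words-suc k (λ w → h (swapAt (suc (suc i)) w)))
    (trans (∑-words-swapAt (suc i) k (λ w → ∑ (range m) (λ a → h (a ∷ w))) (s≤s z≤n) i<k) (sym (∑-words-suc k h)))

  if-cong : ∀ b {f g : Carrier} → (b ≡ true → f ≈ g) → (if b then f else 0#) ≈ (if b then g else 0#)
  if-cong true  eq = eq ≡.refl
  if-cong false eq = refl

  ∑-Sn : ∀ h → ∑ (Sn m) h ≈ ∑ (words m m) (λ w → if distinct w then h w else 0#)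
  ∑-Sn h = ∑-filterᵇ distinct (words m m) h

  ∑-Sn-cong : ∀ {f g : List ℕ → Carrier} → (∀ w → Word m m w → distinct w ≡ true → f w ≈ g w) →
    ∑ (Sn m) f ≈ ∑ (Sn m) g
  ∑-Sn-cong {f} {g} eq = trans (∑-Sn f) (trans
    (∑-words-cong m (λ w ww → if-cong (distinct w) (eq w ww))) (sym (∑-Sn g)))

-- The transition matrix acting on row vectors

module Transition {c ℓ} (F : OrderedField c ℓ)
  (q : OrderedField.Carrier F) (x : ℕ → OrderedField.Carrier F) (n : ℕ)
  (1≤q : OrderedField._≤F_ F (OrderedField.1# F) q)
  (x-pos : ∀ i → 1 ≤ i → i ≤ n → OrderedField._<_ F (OrderedField.0# F) (x i)) where
  open OrderedField F
  open OrderedFieldProperties F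
  open Tsetlin F q x n
  open IntegerSolver commutativeRing
  open Relation.Binary.Reasoning.Setoid setoid
  open HeckeAction F q x n 1≤q x-pos
  open WordSums F n

  ∑-words-select : ∀ k σ (h : List ℕ → Carrier) → Word n k σ →
    ∑ (words n k) (λ w → if eqW w σ then h w else 0#) ≈ h σ
  ∑-words-select zero    []      h _ = +-identityʳ _
  ∑-words-select (suc k) (b ∷ τ) h (len , (1≤b , b≤n) ∷ all) = begin
    ∑ (words n (suc k)) (λ w → if eqW w (b ∷ τ) then h w else 0#)
      ≈⟨ ∑-words-head k _ ⟩
    ∑ (range n) (λ a → ∑ (words n k) (λ w → if (a ≡ᵇ b) ∧ eqW w τ then h (a ∷ w) else 0#))
      ≈⟨ ∑-cong (range n) inner ⟩
    ∑ (range n) (λ a → if a ≡ᵇ b then h (a ∷ τ) else 0#)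
      ≈⟨ ∑-select n b (λ a → h (a ∷ τ)) 1≤b b≤n ⟩
    h (b ∷ τ) ∎
    where
    inner : ∀ a → ∑ (words n k) (λ w → if (a ≡ᵇ b) ∧ eqW w τ then h (a ∷ w) else 0#) ≈ (if a ≡ᵇ b then h (a ∷ τ) else 0#)
    inner a with a ≡ᵇ b
    ... | true  = ∑-words-select k τ (λ w → h (a ∷ w)) (ℕ.suc-injective len , all)
    ... | false = ∑-zero (words n k)

  ⟨_,_⟩ : (List ℕ → Carrier) → (List ℕ → Carrier) → Carrier
  ⟨ f , g ⟩ = ∑ (Sn n) (λ π → f π * g π)

  infix 8 _◁_

  -- The generator acting on column vectors, read directly off `Tword`; `_▷_` is the transpose.
  _◁_ : ℕ → (List ℕ → Carrier) → List ℕ → Carrier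
  (i ◁ g) π = if at π (suc i) <ᵇ at π i
              then q * g (swapAt i π)
              else g (swapAt i π) + (q - 1#) * g π

  -- The part that moves the word is reindexed by the swap, which exchanges ascents and descents
  -- because adjacent letters of a permutation differ; the diagonal part stays in place.
  ◁-adjoint : ∀ i f g → 1 ≤ i → i ℕ.< n → ⟨ f , i ◁ g ⟩ ≈ ⟨ f ▷ i , g ⟩
  ◁-adjoint i f g 1≤i i<n = begin
    ⟨ f , i ◁ g ⟩                                         ≈⟨ ∑-Sn _ ⟩
    ∑ (words n n) (λ w → if distinct w then f w * (i ◁ g) w else 0#)
                                                          ≈⟨ ∑-cong (words n n) split-◁ ⟩
    ∑ (words n n) (λ w → moved w + stayed w)              ≈⟨ ∑-distrib-+ (words n n) moved stayed ⟩
    ∑ (words n n) moved + ∑ (words n n) stayed            ≈⟨ +-congʳ (∑-words-swapAt i n moved 1≤i i<n) ⟨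
    ∑ (words n n) (λ w → moved (swapAt i w)) + ∑ (words n n) stayed
                                                          ≈⟨ ∑-distrib-+ (words n n) _ stayed ⟨
    ∑ (words n n) (λ w → moved (swapAt i w) + stayed w)   ≈⟨ ∑-words-cong n split-▷ ⟩
    ∑ (words n n) (λ w → if distinct w then (f ▷ i) w * g w else 0#)
                                                          ≈⟨ ∑-Sn _ ⟨
    ⟨ f ▷ i , g ⟩                                         ∎
    where
    moved stayed : List ℕ → Carrier
    moved w  = if distinct w then f w * ((if at w (suc i) <ᵇ at w i then q else 1#) * g (swapAt i w)) else 0#
    stayed w = if distinct w then (if at w (suc i) <ᵇ at w i then 0# else f w * ((q - 1#) * g w)) else 0#

    split-◁ : ∀ w → (if distinct w then f w * (i ◁ g) w else 0#) ≈ moved w + stayed w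
    split-◁ w with distinct w | at w (suc i) <ᵇ at w i
    ... | true  | true  = sym (+-identityʳ _)
    ... | true  | false = trans (distribˡ _ _ _) (+-congʳ (*-congˡ (sym (*-identityˡ _))))
    ... | false | _     = sym (+-identityˡ 0#)

    split-▷ : ∀ w → Word n n w → moved (swapAt i w) + stayed w ≈ (if distinct w then (f ▷ i) w * g w else 0#)
    split-▷ w (len , _) with at-swapAt i w 1≤i (subst (i ℕ.<_) (≡.sym len) i<n)
    ... | ati , ati+1 rewrite distinct-swapAt i w | swapAt-involutive i w | ati | ati+1 with distinct w in dw
    ...   | false = +-identityˡ 0#
    ...   | true rewrite <ᵇ-flip (distinct⇒adjacent-≢ i w 1≤i (subst (i ℕ.<_) (≡.sym len) i<n) dw)
      with at w (suc i) <ᵇ at w i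
    ...     | true  = trans (+-identityʳ _) (*-congˡ (*-identityˡ _))
    ...     | false = solve 4 (λ q f f′ g → f :* (q :* g) :+ f′ :* ((q :- con (+ 1)) :* g)
                        := (q :* f :+ (q :- con (+ 1)) :* f′) :* g) refl q (f (swapAt i w)) (f w) (g w)

  -- A linear functional on formal combinations, insensitive to repeated words and to their order in
  -- the list.
  ev : (List ℕ → Carrier) → LC → Carrier
  ev g v = ∑ v (λ t → proj₁ t * g (proj₂ t))

  ev-actT : ∀ g i v → ev g (actT i v) ≈ ev (i ◁ g) v
  ev-actT g i []            = refl
  ev-actT g i ((a , π) ∷ v) with at π (suc i) <ᵇ at π i
  ... | true  = +-cong (*-assoc a q _) (ev-actT g i v)
  ... | false = trans (+-congˡ (+-congˡ (ev-actT g i v)))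
    (solve 5 (λ a q g g′ r → a :* con (+ 1) :* g :+ (a :* (q :- con (+ 1)) :* g′ :+ r)
       := a :* (g :+ (q :- con (+ 1)) :* g′) :+ r) refl a q (g (swapAt i π)) (g π) (ev (i ◁ g) v))

  down◁ : ℕ → (List ℕ → Carrier) → List ℕ → Carrier
  down◁ zero    g = g
  down◁ (suc j) g = suc j ◁ down◁ j g

  down▷ : ℕ → (List ℕ → Carrier) → List ℕ → Carrier
  down▷ zero    f = f
  down▷ (suc j) f = down▷ j (f ▷ suc j)

  ev-actDown : ∀ g j v → ev g (actDown j v) ≈ ev (down◁ j g) v
  ev-actDown g zero    v = refl
  ev-actDown g (suc j) v = trans (ev-actDown g j (actT (suc j) v)) (ev-actT (down◁ j g) (suc j) v)

  down-adjoint : ∀ j f g → j ℕ.< n → ⟨ f , down◁ j g ⟩ ≈ ⟨ down▷ j f , g ⟩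
  down-adjoint zero    f g j<n = refl
  down-adjoint (suc j) f g j<n = trans (◁-adjoint (suc j) f (down◁ j g) (s≤s z≤n) j<n)
    (down-adjoint j (f ▷ suc j) g (ℕ.<⇒≤ j<n))

  down▷-+ : ∀ j f g σ → down▷ j (λ τ → f τ + g τ) σ ≈ down▷ j f σ + down▷ j g σ
  down▷-cong : ∀ j {f g} → (∀ σ → f σ ≈ g σ) → ∀ σ → down▷ j f σ ≈ down▷ j g σ
  down▷-cong zero    eq = eq
  down▷-cong (suc j) eq = down▷-cong j (▷-cong (suc j) eq)
  down▷-+ zero    f g σ = refl
  down▷-+ (suc j) f g σ = trans (down▷-cong j (▷-+ f g (suc j)) σ) (down▷-+ j (f ▷ suc j) (g ▷ suc j) σ)

  -- All summands end with the same generators, of indices `j` down to 1. Since `down▷ j` is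
  -- additive this common tail factors out, and the case `j = 0` is the Horner form of the whole
  -- operator.
  ∑-down▷ : ∀ k j f σ → ∑ (range (suc k)) (λ i → down▷ (j ℕ.+ (i ∸ 1)) f σ) ≈ down▷ j (horner k j f) σ
  ∑-down▷ zero    j f σ = trans (+-identityʳ _) (reflexive (cong (λ i → down▷ i f σ) (ℕ.+-identityʳ j)))
  ∑-down▷ (suc k) j f σ = begin
    ∑ (range (suc (suc k))) (λ i → down▷ (j ℕ.+ (i ∸ 1)) f σ)
      ≡⟨ ∑-head (suc k) (λ i → down▷ (j ℕ.+ (i ∸ 1)) f σ) ⟩
    down▷ (j ℕ.+ 0) f σ + ∑ (range (suc k)) (λ i → down▷ (j ℕ.+ i) f σ)
      ≈⟨ +-cong (reflexive (cong (λ i → down▷ i f σ) (ℕ.+-identityʳ j))) (∑-range-cong (suc k) shift) ⟩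
    down▷ j f σ + ∑ (range (suc k)) (λ i → down▷ (suc j ℕ.+ (i ∸ 1)) f σ)
      ≈⟨ +-congˡ (∑-down▷ k (suc j) f σ) ⟩
    down▷ j f σ + down▷ j (horner k (suc j) f ▷ suc j) σ
      ≈⟨ down▷-+ j f (horner k (suc j) f ▷ suc j) σ ⟨
    down▷ j (horner (suc k) j f) σ ∎
    where
    shift : ∀ i → 1 ≤ i → i ≤ suc k → down▷ (j ℕ.+ i) f σ ≈ down▷ (suc j ℕ.+ (i ∸ 1)) f σ
    shift (suc i) _ _ = reflexive (cong (λ l → down▷ l f σ) (ℕ.+-suc j i))

  ξ : List ℕ → Carrier
  ξ τ = x (at τ 1) * qpow (ℤ.- (+ (n ∸ at τ 1)))

  -- Column `σ` of the diagonal map; pairing with it reads off the entry at `σ`.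
  ξδ : List ℕ → List ℕ → Carrier
  ξδ σ τ = if eqW τ σ then ξ τ else 0#

  coeff-actX : ∀ σ v → coeff σ (actX v) ≈ ev (ξδ σ) v
  coeff-actX σ []            = refl
  coeff-actX σ ((a , π) ∷ v) with eqW π σ
  ... | true  = +-congˡ (coeff-actX σ v)
  ... | false = +-cong (sym (zeroʳ a)) (coeff-actX σ v)

  M-expand : ∀ π σ → M π σ ≈ ∑ (range n) (λ i → down◁ (i ∸ 1) (ξδ σ) π)
  M-expand π σ = trans (∑-concatMap (λ i → actX (actDown (i ∸ 1) ((1# , π) ∷ []))) (range n) _)
    (∑-cong (range n) (λ i → begin
      coeff σ (actX (actDown (i ∸ 1) ((1# , π) ∷ [])))   ≈⟨ coeff-actX σ (actDown (i ∸ 1) ((1# , π) ∷ [])) ⟩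
      ev (ξδ σ) (actDown (i ∸ 1) ((1# , π) ∷ []))        ≈⟨ ev-actDown (ξδ σ) (i ∸ 1) ((1# , π) ∷ []) ⟩
      1# * down◁ (i ∸ 1) (ξδ σ) π + 0#                   ≈⟨ trans (+-identityʳ _) (*-identityˡ _) ⟩
      down◁ (i ∸ 1) (ξδ σ) π                             ∎))

  ⟨-,ξδ⟩ : ∀ h {σ} → Word n n σ → distinct σ ≡ true → ⟨ h , ξδ σ ⟩ ≈ h σ * ξ σ
  ⟨-,ξδ⟩ h {σ} word dσ = begin
    ⟨ h , ξδ σ ⟩                                                                    ≈⟨ ∑-Sn _ ⟩
    ∑ (words n n) (λ w → if distinct w then h w * ξδ σ w else 0#)                   ≈⟨ ∑-cong (words n n) pull-out ⟩
    ∑ (words n n) (λ w → if eqW w σ then (if distinct w then h w * ξ w else 0#) else 0#)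
                                                                                    ≈⟨ ∑-words-select n σ (λ w → if distinct w then h w * ξ w else 0#) word ⟩
    (if distinct σ then h σ * ξ σ else 0#)                                          ≡⟨ cong (λ e → if e then h σ * ξ σ else 0#) dσ ⟩
    h σ * ξ σ                                                                       ∎
    where
    pull-out : ∀ w → (if distinct w then h w * ξδ σ w else 0#) ≈ (if eqW w σ then (if distinct w then h w * ξ w else 0#) else 0#)
    pull-out w with distinct w | eqW w σ
    ... | true  | true  = refl
    ... | true  | false = zeroʳ _
    ... | false | true  = refl
    ... | false | false = refl

  -- Expanding `M` yields generators acting on the column `ξδ σ`. Adjointness moves them all onto
  -- the row vector, where the sum takes Horner form.
  row-action : ∀ f {σ} → 1 ≤ n → Word n n σ → distinct σ ≡ true →
    ∑ (Sn n) (λ π → f π * M π σ) ≈ horner (n ∸ 1) 0 f σ * ξ σ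
  row-action f {σ} 1≤n word dσ = begin
    ∑ (Sn n) (λ π → f π * M π σ)
      ≈⟨ ∑-cong (Sn n) (λ π → trans (*-congˡ (M-expand π σ)) (*-distribˡ-∑ (range n) (f π) _)) ⟩
    ∑ (Sn n) (λ π → ∑ (range n) (λ i → f π * down◁ (i ∸ 1) (ξδ σ) π))
      ≈⟨ ∑-swap (Sn n) (range n) (λ π i → f π * down◁ (i ∸ 1) (ξδ σ) π) ⟩
    ∑ (range n) (λ i → ⟨ f , down◁ (i ∸ 1) (ξδ σ) ⟩)
      ≈⟨ ∑-range-cong n (λ i 1≤i i≤n → trans (down-adjoint (i ∸ 1) f (ξδ σ) (pred< i 1≤i i≤n))
           (trans (⟨-,ξδ⟩ (down▷ (i ∸ 1) f) word dσ) (*-comm _ _))) ⟩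
    ∑ (range n) (λ i → ξ σ * down▷ (i ∸ 1) f σ)
      ≈⟨ *-distribˡ-∑ (range n) (ξ σ) _ ⟨
    ξ σ * ∑ (range n) (λ i → down▷ (i ∸ 1) f σ)
      ≈⟨ *-congˡ (sum-as-horner n 1≤n) ⟩
    ξ σ * horner (n ∸ 1) 0 f σ
      ≈⟨ *-comm _ _ ⟩
    horner (n ∸ 1) 0 f σ * ξ σ ∎
    where
    pred< : ∀ i → 1 ≤ i → i ≤ n → i ∸ 1 ℕ.< n
    pred< (suc i) _ i<n = i<n
    sum-as-horner : ∀ m → 1 ≤ m → ∑ (range m) (λ i → down▷ (i ∸ 1) f σ) ≈ horner (m ∸ 1) 0 f σ
    sum-as-horner (suc m) _ = ∑-down▷ m 0 f σ

-- Permutations as enumerations, and their inversions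

mem : List ℕ → ℕ → Bool
mem w a = anyᵇ (λ b → a ≡ᵇ b) w

data Simple (n : ℕ) : List ℕ → Set where
  []  : Simple n []
  _∷_ : ∀ {a w} → (1 ≤ a × a ≤ n) × mem w a ≡ false → Simple n w → Simple n (a ∷ w)

distinct⇒Simple : ∀ {n w} → All (λ a → 1 ≤ a × a ≤ n) w → distinct w ≡ true → Simple n w
distinct⇒Simple []           _  = []
distinct⇒Simple (_∷_ {x = a} {xs = w} r rs) dw with ∧-true {not (mem w a)} dw
... | ∉w , dw′ = (r , not-true ∉w) ∷ distinct⇒Simple rs dw′

mem-++ : ∀ u v c → mem (u ++ v) c ≡ mem u c ∨ mem v c
mem-++ []      v c = ≡.refl
mem-++ (b ∷ u) v c = ≡.trans (cong ((c ≡ᵇ b) ∨_) (mem-++ u v c)) (≡.sym (∨-assoc (c ≡ᵇ b) (mem u c) (mem v c)))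

Simple-++ˡ : ∀ {n} u {v} → Simple n (u ++ v) → Simple n u
Simple-++ˡ []      s             = []
Simple-++ˡ (b ∷ u) {v} ((r , b∉) ∷ s) = (r , proj₁ (∨-false (≡.trans (≡.sym (mem-++ u v b)) b∉))) ∷ Simple-++ˡ u s

Simple-++-middle : ∀ {n} u {a v} → Simple n (u ++ a ∷ v) → (1 ≤ a × a ≤ n) × mem u a ≡ false
Simple-++-middle []              ((r , _) ∷ _)  = r , ≡.refl
Simple-++-middle (b ∷ u) {a} {v} ((_ , b∉) ∷ s) with Simple-++-middle u s
... | r , a∉u = r , cong₂ _∨_ (≢⇒≡ᵇ {a} {b} (λ a≡b → ≡ᵇ-false⇒≢ {b} {a} (proj₁ (∨-false
      (proj₂ (∨-false {mem u b} (≡.trans (≡.sym (mem-++ u (a ∷ v) b)) b∉))))) (≡.sym a≡b))) a∉u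

Simple-∷ʳ : ∀ {n v a} → Simple n v → 1 ≤ a × a ≤ n → mem v a ≡ false → Simple n (v ++ a ∷ [])
Simple-∷ʳ []                 ra a∉v = (ra , ≡.refl) ∷ []
Simple-∷ʳ {a = a} (_∷_ {b} {v} (rb , b∉v) s) ra a∉ with ∨-false a∉
... | a≢b , a∉v = (rb , ≡.trans (mem-++ v (a ∷ []) b) (cong₂ _∨_ b∉v
        (cong (_∨ false) (≡.trans (≡ᵇ-sym b a) a≢b)))) ∷ Simple-∷ʳ s ra a∉v

mem-∷ʳ : ∀ v a c → mem (v ++ a ∷ []) c ≡ (mem v ⊕ a) c
mem-∷ʳ v a c = ≡.trans (mem-++ v (a ∷ []) c) (≡.trans (∨-comm (mem v c) _) (cong (_∨ mem v c) (∨-identityʳ (c ≡ᵇ a))))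

Simple⇒absent : ∀ {n w} → Simple n w → absent (mem w) n ℕ.+ length w ≡ n
Simple⇒absent {n} []  = ≡.trans (ℕ.+-identityʳ _) (absent-∅ n)
Simple⇒absent {n} (_∷_ {a} {w} ((1≤a , a≤n) , a∉w) s) = ≡.trans (ℕ.+-suc _ (length w))
  (≡.trans (cong (ℕ._+ length w) (absent-⊕≥ (mem w) n a∉w 1≤a a≤n)) (Simple⇒absent s))

absent≡0⇒full : ∀ U m → absent U m ≡ 0 → ∀ c → 1 ≤ c → c ≤ m → U c ≡ true
absent≡0⇒full U zero    _ (suc c) _ ()
absent≡0⇒full U (suc m) eq c 1≤c c≤1+m with U (suc m) in eqU
... | true with c ℕ.≟ suc m
...   | yes ≡.refl = eqU
...   | no c≢      = absent≡0⇒full U m eq c 1≤c (ℕ.≤-pred (ℕ.≤∧≢⇒< c≤1+m c≢))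
absent≡0⇒full U (suc m) () c 1≤c c≤1+m | false

absent-witness : ∀ U m {k} → absent U m ≡ suc k → ∃ λ c → (1 ≤ c × c ≤ m) × U c ≡ false
absent-witness U zero    ()
absent-witness U (suc m) eq with U (suc m) in eqU
... | false = suc m , (s≤s z≤n , ℕ.≤-refl) , eqU
... | true with absent-witness U m eq
...   | c , (1≤c , c≤m) , Uc = c , (1≤c , ℕ.m≤n⇒m≤1+n c≤m) , Uc

-- Pigeonhole by counting: each letter read lowers `absent` by one, so at the end of the word it is
-- zero and every letter has been used.
Simple⇒Enumerates : ∀ {n U w} → Simple n w → (∀ c → mem w c ≡ true → U c ≡ false) →
  absent U n ≡ length w → Enumerates n U w
Simple⇒Enumerates {n} {U} [] _ eq = [] (absent≡0⇒full U n eq)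
Simple⇒Enumerates {n} {U} (_∷_ {a} {w} ((1≤a , a≤n) , a∉w) s) disjoint eq =
  ((1≤a , a≤n) , Ua) ∷ Simple⇒Enumerates s disjoint′
    (ℕ.suc-injective (≡.trans (absent-⊕≥ U n Ua 1≤a a≤n) eq))
  where
  Ua : U a ≡ false
  Ua = disjoint a (cong (_∨ mem w a) (≡ᵇ-refl a))
  disjoint′ : ∀ c → mem w c ≡ true → (U ⊕ a) c ≡ false
  disjoint′ c c∈w with c ℕ.≟ a
  ... | yes ≡.refl with ≡.trans (≡.sym c∈w) a∉w
  ...   | ()
  disjoint′ c c∈w | no c≢a = ≡.trans (⊕-other U c≢a)
    (disjoint c (≡.trans (cong ((c ≡ᵇ a) ∨_) c∈w) (∨-zeroʳ (c ≡ᵇ a))))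

Enumerates⇒count : ∀ {n U w} → Enumerates n U w → ∀ m → m ≤ n → absent U m ≡ length (filterᵇ (λ b → b <ᵇ suc m) w)
Enumerates⇒count {U = U} ([] full) m m≤n = absent-full U m (λ c 1≤c c≤m → full c 1≤c (ℕ.≤-trans c≤m m≤n))
Enumerates⇒count {n} {U} (_∷_ {a} {w} ((1≤a , a≤n) , Ua) e) m m≤n with a <ᵇ suc m in eq
... | true  = ≡.trans (≡.sym (absent-⊕≥ U m Ua 1≤a (ℕ.≤-pred (<ᵇ-true⇒< eq)))) (cong suc (Enumerates⇒count e m m≤n))
... | false = ≡.trans (≡.sym (absent-⊕< U (<ᵇ-false⇒≥ {a} {suc m} eq))) (Enumerates⇒count e m m≤n)

inv-∷ : ∀ {n U a w} → Enumerates n U (a ∷ w) → inv (a ∷ w) ≡ absent U (a ∸ 1) ℕ.+ inv w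
inv-∷ {n} {U} {suc a} {w} e@(((1≤a , a<n) , _) ∷ _) = cong (ℕ._+ inv w) (≡.sym
  (≡.trans (Enumerates⇒count e a (ℕ.<⇒≤ a<n)) skip-head))
  where
  skip-head : length (filterᵇ (λ b → b <ᵇ suc a) (suc a ∷ w)) ≡ length (filterᵇ (λ b → b <ᵇ suc a) w)
  skip-head rewrite ≥⇒<ᵇ-false {a} {a} ℕ.≤-refl = ≡.refl

-- Decreasing rearrangements

-- The scan over letter values branches as `carry` does, so `κdec` of a sorted word can be compared
-- with `carry` case by case.
desc : (ℕ → Bool) → ℕ → List ℕ
desc U zero    = []
desc U (suc m) = if U (suc m) then suc m ∷ desc U m else desc U m

desc-cong : ∀ {U V} m → (∀ c → c ≤ m → U c ≡ V c) → desc U m ≡ desc V m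
desc-cong zero    eq = ≡.refl
desc-cong (suc m) eq = cong₂ (λ e l → if e then suc m ∷ l else l) (eq (suc m) ℕ.≤-refl)
  (desc-cong m (λ c c≤m → eq c (ℕ.m≤n⇒m≤1+n c≤m)))

insertDesc-largest : ∀ U {a} m → m ℕ.< a → insertDesc a (desc U m) ≡ a ∷ desc U m
insertDesc-largest U zero    m<a = ≡.refl
insertDesc-largest U {a} (suc m) m<a with U (suc m)
... | true rewrite <⇒<ᵇ-true m<a = ≡.refl
... | false = insertDesc-largest U m (ℕ.<-trans ℕ.≤-refl m<a)

insertDesc-desc : ∀ U {a} m → U a ≡ false → 1 ≤ a → a ≤ m → insertDesc a (desc U m) ≡ desc (U ⊕ a) m
insertDesc-desc U {suc a} zero Ua 1≤a ()
insertDesc-desc U {a} (suc m) Ua 1≤a a≤1+m with a ℕ.≟ suc m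
... | yes ≡.refl rewrite ≡ᵇ-refl m | Ua = ≡.trans (insertDesc-largest U {suc m} m ℕ.≤-refl)
        (cong (suc m ∷_) (desc-cong m (λ c c≤m → ≡.sym (⊕-below U {suc m} {m} ℕ.≤-refl c c≤m))))
... | no a≢1+m rewrite ⊕-other U (λ eq → a≢1+m (≡.sym eq)) with U (suc m)
...   | true rewrite ≥⇒<ᵇ-false a≤1+m = cong (suc m ∷_) (insertDesc-desc U m Ua 1≤a (ℕ.≤-pred (ℕ.≤∧≢⇒< a≤1+m a≢1+m)))
...   | false = insertDesc-desc U m Ua 1≤a (ℕ.≤-pred (ℕ.≤∧≢⇒< a≤1+m a≢1+m))

desc-∅ : ∀ m → desc ∅ m ≡ []
desc-∅ zero    = ≡.refl
desc-∅ (suc m) = desc-∅ m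

sortDesc-Simple : ∀ {n w} → Simple n w → sortDesc w ≡ desc (mem w) n
sortDesc-Simple {n} [] = ≡.sym (desc-∅ n)
sortDesc-Simple {n} (_∷_ {a} {w} ((1≤a , a≤n) , a∉w) s) =
  ≡.trans (cong (insertDesc a) (sortDesc-Simple s)) (insertDesc-desc (mem w) n a∉w 1≤a a≤n)

all-letters : ℕ → Bool
all-letters _ = true

sortDesc-all : ∀ m → sortDesc (desc all-letters m) ≡ desc all-letters m
sortDesc-all zero    = ≡.refl
sortDesc-all (suc m) = ≡.trans (cong (insertDesc (suc m)) (sortDesc-all m)) (insertDesc-largest all-letters {suc m} m ℕ.≤-refl)

w0≡desc : ∀ m → w0 m ≡ desc all-letters m
w0≡desc m = ≡.trans (≡.sym (reverse-map suc (upTo m))) (≡.trans (cong (map suc) (reverse-upTo m)) (down m))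
  where
  down : ∀ m → map suc (downFrom m) ≡ desc all-letters m
  down zero    = ≡.refl
  down (suc m) = cong (suc m ∷_) (down m)

length-desc : ∀ U m → length (desc U m) ℕ.+ absent U m ≡ m
length-desc U zero    = ≡.refl
length-desc U (suc m) with U (suc m)
... | true  = cong suc (length-desc U m)
... | false = ≡.trans (ℕ.+-suc _ _) (cong suc (length-desc U m))

-- Left-to-right minima and the slices in the numerator

at-middle : ∀ u a w → at (u ++ a ∷ w) (suc (length u)) ≡ a
at-middle []      a w = ≡.refl
at-middle (b ∷ u) a w = at-middle u a w

take-middle : ∀ (u : List ℕ) a w → take (suc (length u)) (u ++ a ∷ w) ≡ u ++ a ∷ []
take-middle []      a w = ≡.refl
take-middle (b ∷ u) a w = cong (b ∷_) (take-middle u a w)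

take-prefix : ∀ u (w : List ℕ) → take (length u) (u ++ w) ≡ u
take-prefix []      w = ≡.refl
take-prefix (b ∷ u) w = cong (b ∷_) (take-prefix u w)

split-at : ∀ k (π : List ℕ) → k ℕ.< length π → take k π ++ at π (suc k) ∷ drop (suc k) π ≡ π × length (take k π) ≡ k
split-at zero    (a ∷ π) _ = ≡.refl , ≡.refl
split-at (suc k) (a ∷ π) (s≤s k<) with split-at k π k<
... | eq , len = cong (a ∷_) eq , cong suc len

-- The slice π_{p_k} … π_{k−1} agrees with the whole prefix u = π_1 … π_{k−1} on the letters below a = π_k.
data SliceView (n : ℕ) (π u : List ℕ) (a k : ℕ) : Set where
  lrm     : isLRM π k ≡ true → (∀ c → c ℕ.< a → mem u c ≡ false) → SliceView n π u a k
  non-lrm : ∀ i v → isLRM π k ≡ false → pPos π k ≡ suc i →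
            slice π (suc i) k ≡ v ++ a ∷ [] → slice π (suc i) (k ∸ 1) ≡ v →
            (∀ c → c ℕ.< a → mem v c ≡ mem u c) → mem v a ≡ false → Simple n v → SliceView n π u a k

isLRM-∷ : ∀ b π k → isLRM (b ∷ π) (suc (suc k)) ≡ (at π (suc k) <ᵇ b) ∧ isLRM π (suc k)
isLRM-∷ b π k = ≡.trans (cong (allᵇ (λ i → at π (suc k) <ᵇ at (b ∷ π) i)) (range-head k))
  (cong ((at π (suc k) <ᵇ b) ∧_) (shift (upTo k)))
  where
  shift : ∀ l → allᵇ (λ i → at π (suc k) <ᵇ at (b ∷ π) i) (map suc (map suc l)) ≡ allᵇ (λ i → at π (suc k) <ᵇ at π i) (map suc l)
  shift []      = ≡.refl
  shift (i ∷ l) = cong ((at π (suc k) <ᵇ at π (suc i)) ∧_) (shift l)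

-- Shifts a position past a prepended letter but keeps 0, the value of `pPos` when no position
-- qualifies.
bump : ℕ → ℕ
bump zero    = zero
bump (suc i) = suc (suc i)

pPos-∷ : ∀ b π k → pPos (b ∷ π) (suc (suc k)) ≡ (if b <ᵇ at π (suc k) then 1 else bump (pPos π (suc k)))
pPos-∷ b π k = ≡.trans (cong (firstBelow (b ∷ π) (suc (suc k))) (range-head k))
  (cong (λ r → if b <ᵇ at π (suc k) then 1 else r) (shift (upTo k)))
  where
  shift : ∀ l → firstBelow (b ∷ π) (suc (suc k)) (map suc (map suc l)) ≡ bump (firstBelow π (suc k) (map suc l))
  shift []      = ≡.refl
  shift (i ∷ l) with at π (suc i) <ᵇ at π (suc k)
  ... | true  = ≡.refl
  ... | false = shift l

sliceView : ∀ {n} u a w → Simple n u → mem u a ≡ false → SliceView n (u ++ a ∷ w) u a (suc (length u))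
sliceView []      a w _ _ = lrm ≡.refl (λ _ _ → ≡.refl)
sliceView (b ∷ u) a w simple@(_ ∷ s) a∉ with a <ᵇ b in eq
... | false = non-lrm 0 (b ∷ u)
      (≡.trans (isLRM-∷ b (u ++ a ∷ w) (length u)) (cong (_∧ isLRM (u ++ a ∷ w) (suc (length u))) (≡.trans (cong (_<ᵇ b) (at-middle u a w)) eq)))
      (≡.trans (pPos-∷ b (u ++ a ∷ w) (length u)) (cong (λ e → if e then 1 else bump (pPos (u ++ a ∷ w) (suc (length u))))
        (≡.trans (cong (b <ᵇ_) (at-middle u a w)) (<⇒<ᵇ-true {b} {a} (ℕ.≤∧≢⇒< (<ᵇ-false⇒≥ {a} {b} eq) b≢a)))))
      (take-middle (b ∷ u) a w) (take-prefix (b ∷ u) (a ∷ w)) (λ _ _ → ≡.refl) a∉ simple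
  where
  b≢a : b ≢ a
  b≢a b≡a = ≡ᵇ-false⇒≢ {a} {b} (proj₁ (∨-false a∉)) (≡.sym b≡a)
... | true with sliceView u a w s (proj₂ (∨-false {a ≡ᵇ b} a∉))
...   | lrm min above = lrm
        (≡.trans (isLRM-∷ b (u ++ a ∷ w) (length u)) (cong₂ _∧_ (≡.trans (cong (_<ᵇ b) (at-middle u a w)) eq) min))
        (λ c c<a → cong₂ _∨_ (≢⇒≡ᵇ {c} {b} (ℕ.<⇒≢ (ℕ.<-trans c<a (<ᵇ-true⇒< {a} {b} eq)))) (above c c<a))
...   | non-lrm i v nmin pos sl₁ sl₂ agree a∉v sv = non-lrm (suc i) v
        (≡.trans (isLRM-∷ b (u ++ a ∷ w) (length u)) (≡.trans (cong ((at (u ++ a ∷ w) (suc (length u)) <ᵇ b) ∧_) nmin) (∧-zeroʳ _)))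
        (≡.trans (pPos-∷ b (u ++ a ∷ w) (length u)) (cong₂ (λ e r → if e then 1 else bump r)
          (≡.trans (cong (b <ᵇ_) (at-middle u a w)) (≥⇒<ᵇ-false {b} {a} (ℕ.<⇒≤ (<ᵇ-true⇒< {a} {b} eq)))) pos))
        sl₁ sl₂
        (λ c c<a → ≡.trans (agree c c<a) (≡.sym (cong (_∨ mem u c) (≢⇒≡ᵇ {c} {b} (ℕ.<⇒≢ (ℕ.<-trans c<a (<ᵇ-true⇒< {a} {b} eq)))))))
        a∉v sv

-- Distinctness relative to a used set

-- Distinctness with the letters already read as accumulator, the recursion followed by `R`;
-- `distinct` compares each letter with the later ones instead.
good : (ℕ → Bool) → List ℕ → Bool
good U []      = true
good U (a ∷ w) = if U a then false else good (U ⊕ a) w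

allᵇ-⊕ : ∀ U a w → allᵇ (λ b → not ((U ⊕ a) b)) w ≡ not (mem w a) ∧ allᵇ (λ b → not (U b)) w
allᵇ-⊕ U a []      = ≡.refl
allᵇ-⊕ U a (b ∷ w) rewrite allᵇ-⊕ U a w | ≡ᵇ-sym b a with a ≡ᵇ b | U b
... | true  | _     = ≡.refl
... | false | true  = ≡.sym (∧-zeroʳ _)
... | false | false = ≡.refl

good≡ : ∀ U w → good U w ≡ distinct w ∧ allᵇ (λ b → not (U b)) w
good≡ U []      = ≡.refl
good≡ U (a ∷ w) with U a
... | true  = ≡.sym (∧-zeroʳ _)
... | false rewrite good≡ (U ⊕ a) w | allᵇ-⊕ U a w with mem w a
...   | true  = ∧-zeroʳ _
...   | false = ≡.refl

distinct≡good : ∀ w → distinct w ≡ good ∅ w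
distinct≡good w = ≡.sym (≡.trans (good≡ ∅ w) (≡.trans (cong (distinct w ∧_) (all-true w)) (∧-identityʳ _)))
  where
  all-true : ∀ w → allᵇ (λ b → not (∅ b)) w ≡ true
  all-true []      = ≡.refl
  all-true (b ∷ w) = all-true w

_⊕*_ : (ℕ → Bool) → List ℕ → ℕ → Bool
U ⊕* []      = U
U ⊕* (a ∷ l) = (U ⊕ a) ⊕* l

⊕*≡mem : ∀ U l c → (U ⊕* l) c ≡ mem l c ∨ U c
⊕*≡mem U []      c = ≡.refl
⊕*≡mem U (a ∷ l) c = ≡.trans (⊕*≡mem (U ⊕ a) l c) (≡.trans (≡.sym (∨-assoc (mem l c) (c ≡ᵇ a) (U c)))
  (cong (_∨ U c) (∨-comm (mem l c) (c ≡ᵇ a))))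

∅⊕*≡mem : ∀ l c → (∅ ⊕* l) c ≡ mem l c
∅⊕*≡mem l c = ≡.trans (⊕*≡mem ∅ l c) (∨-identityʳ (mem l c))

≤pred⇒< : ∀ {a c} → 1 ≤ a → c ≤ a ∸ 1 → c ℕ.< a
≤pred⇒< {suc a} _ c≤ = s≤s c≤

-- Identification of the product formula, total mass and stationarity

module StationaryDistribution {c ℓ} (F : OrderedField c ℓ)
  (q : OrderedField.Carrier F) (x : ℕ → OrderedField.Carrier F) (n : ℕ)
  (1≤q : OrderedField._≤F_ F (OrderedField.1# F) q)
  (x-pos : ∀ i → 1 ≤ i → i ≤ n → OrderedField._<_ F (OrderedField.0# F) (x i)) where
  open OrderedField F
  open OrderedFieldProperties F
  open Tsetlin F q x n
  open IntegerSolver commutativeRing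
  open Relation.Binary.Reasoning.Setoid setoid
  open SequentialSampling F q x n 1≤q x-pos
  open HeckeAction F q x n 1≤q x-pos
  open WordSums F n
  open Transition F q x n 1≤q x-pos
  module ℤS = Data.Integer.Solver.+-*-Solver

  powℕ-+ : ∀ a j k → powℕ a (j ℕ.+ k) ≈ powℕ a j * powℕ a k
  powℕ-+ a zero    k = sym (*-identityˡ _)
  powℕ-+ a (suc j) k = trans (*-congˡ (powℕ-+ a j k)) (sym (*-assoc _ _ _))

  qpow-neg : ∀ k → qpow (ℤ.- (+ k)) ≡ powℕ p k
  qpow-neg zero    = ≡.refl
  qpow-neg (suc k) = ≡.refl

  -- The exponent depends on position and length only through their difference, which is unchanged
  -- when a first letter is removed.
  κdec-∷ : ∀ a v → κdec (a ∷ v) ≈ x a * qpow ((+ 1) ℤ.+ (+ a) ℤ.- (+ suc (length v)) ℤ.- (+ 1)) + κdec v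
  κdec-∷ a v = trans (reflexive (∑-head (length v) _)) (+-congˡ (∑-range-cong (length v) shift))
    where
    exponent : ∀ i b k → (+ suc i) ℤ.+ b ℤ.- (+ suc k) ℤ.- (+ 1) ≡ (+ i) ℤ.+ b ℤ.- (+ k) ℤ.- (+ 1)
    exponent i b k = ℤS.solve 3 (λ i b k → (ℤS.con (+ 1) ℤS.:+ i) ℤS.:+ b ℤS.:- (ℤS.con (+ 1) ℤS.:+ k) ℤS.:- ℤS.con (+ 1)
      ℤS.:= i ℤS.:+ b ℤS.:- k ℤS.:- ℤS.con (+ 1)) ≡.refl (+ i) b (+ k)
    shift : ∀ i → 1 ≤ i → i ≤ length v →
      x (at (a ∷ v) (suc i)) * qpow ((+ suc i) ℤ.+ (+ at (a ∷ v) (suc i)) ℤ.- (+ suc (length v)) ℤ.- (+ 1))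
      ≈ x (at v i) * qpow ((+ i) ℤ.+ (+ at v i) ℤ.- (+ length v) ℤ.- (+ 1))
    shift (suc i) _ _ = *-congˡ (reflexive (cong qpow (exponent (suc i) (+ at v (suc i)) (length v))))

  κdec-desc : ∀ U m → κdec (desc U m) ≈ powℕ q (absent U m) * carry U m
  κdec-desc U zero    = sym (zeroʳ _)
  κdec-desc U (suc m) with U (suc m)
  ... | true  = begin
    κdec (suc m ∷ desc U m)
      ≈⟨ κdec-∷ (suc m) (desc U m) ⟩
    x (suc m) * qpow ((+ 1) ℤ.+ (+ suc m) ℤ.- (+ suc (length (desc U m))) ℤ.- (+ 1)) + κdec (desc U m)
      ≈⟨ +-cong (*-congˡ (reflexive (cong qpow exponent))) (κdec-desc U m) ⟩
    x (suc m) * powℕ q (absent U m) + powℕ q (absent U m) * carry U m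
      ≈⟨ solve 3 (λ y Q k → y :* Q :+ Q :* k := Q :* (k :+ y)) refl (x (suc m)) (powℕ q (absent U m)) (carry U m) ⟩
    powℕ q (absent U m) * (carry U m + x (suc m)) ∎
    where
    exponent : (+ 1) ℤ.+ (+ suc m) ℤ.- (+ suc (length (desc U m))) ℤ.- (+ 1) ≡ + absent U m
    exponent = ≡.trans (cong (λ j → (+ 1) ℤ.+ (+ suc j) ℤ.- (+ suc (length (desc U m))) ℤ.- (+ 1)) (≡.sym (length-desc U m)))
      (ℤS.solve 2 (λ l z → ℤS.con (+ 1) ℤS.:+ (ℤS.con (+ 1) ℤS.:+ (l ℤS.:+ z)) ℤS.:- (ℤS.con (+ 1) ℤS.:+ l) ℤS.:- ℤS.con (+ 1) ℤS.:= z)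
        ≡.refl (+ length (desc U m)) (+ absent U m))
  ... | false = begin
    κdec (desc U m)                                          ≈⟨ κdec-desc U m ⟩
    Q * carry U m                                            ≈⟨ *-identityˡ _ ⟨
    1# * (Q * carry U m)                                     ≈⟨ *-congʳ qp≈1 ⟨
    (q * p) * (Q * carry U m)                                ≈⟨ solve 4 (λ q p Q k → (q :* p) :* (Q :* k) := (q :* Q) :* (p :* k)) refl q p Q (carry U m) ⟩
    (q * Q) * (p * carry U m)                                ∎
    where Q = powℕ q (absent U m)

  κ-Simple : ∀ {w} → Simple n w → κ w ≈ powℕ q (absent (mem w) n) * carry (mem w) n
  κ-Simple {w} s = trans (reflexive (cong κdec (sortDesc-Simple s))) (κdec-desc (mem w) n)

  κ-w0 : κ (w0 n) ≈ sumX
  κ-w0 = begin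
    κ (w0 n)                             ≡⟨ cong κdec (≡.trans (cong sortDesc (w0≡desc n)) (sortDesc-all n)) ⟩
    κdec (desc all-letters n)            ≈⟨ κdec-desc all-letters n ⟩
    powℕ q (absent all-letters n) * k    ≡⟨ cong (λ z → powℕ q z * k) (absent-full all-letters n (λ _ _ _ → ≡.refl)) ⟩
    -- The carry is rewritten through `D`, which vanishes when every letter is used.
    1# * k                               ≈⟨ solve 2 (λ k s → con (+ 1) :* k := s :- (s :- k)) refl k sumX ⟩
    sumX - D all-letters                 ≈⟨ +-congˡ (-‿cong (deficit-full all-letters (λ _ _ _ → ≡.refl))) ⟩
    sumX - 0#                            ≈⟨ solve 1 (λ s → s :- con (+ 0) := s) refl sumX ⟩
    sumX                                 ∎
    where k = carry all-letters n

  Dfac≈D : ∀ π k → Simple n (take k π) → length (take k π) ≡ k → Dfac π (suc k) ≈ D (mem (take k π))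
  Dfac≈D π k s len = +-cong κ-w0 (-‿cong (begin
    qpow ((+ suc k) ℤ.- (+ n) ℤ.- (+ 1)) * κ u        ≈⟨ *-cong (reflexive (≡.trans (cong qpow exponent) (qpow-neg z))) (κ-Simple s) ⟩
    powℕ p z * (powℕ q z * carry (mem u) n)           ≈⟨ *-assoc _ _ _ ⟨
    powℕ p z * powℕ q z * carry (mem u) n             ≈⟨ *-congʳ (trans (*-comm _ _) (qᵏpᵏ≈1 z)) ⟩
    1# * carry (mem u) n                              ≈⟨ *-identityˡ _ ⟩
    carry (mem u) n                                   ∎))
    where
    u = take k π
    z = absent (mem u) n
    exponent : (+ suc k) ℤ.- (+ n) ℤ.- (+ 1) ≡ ℤ.- (+ z)
    exponent = ≡.trans (cong (λ m → (+ suc k) ℤ.- (+ m) ℤ.- (+ 1))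
        (≡.trans (≡.sym (Simple⇒absent s)) (cong (z ℕ.+_) len)))
      (ℤS.solve 2 (λ k z → (ℤS.con (+ 1) ℤS.:+ k) ℤS.:- (z ℤS.:+ k) ℤS.:- ℤS.con (+ 1) ℤS.:= ℤS.:- z) ≡.refl (+ k) (+ z))

  κ-∷ʳ : ∀ {v a} → Simple n v → 1 ≤ a × a ≤ n → mem v a ≡ false →
    κ (v ++ a ∷ []) - p * κ v ≈ powℕ q (absent (mem v) (a ∸ 1)) * W (mem v) a
  κ-∷ʳ {v} {a} s (1≤a , a≤n) a∉v = begin
    κ (v ++ a ∷ []) - p * κ v
      ≈⟨ +-cong (κ-Simple (Simple-∷ʳ s (1≤a , a≤n) a∉v)) (-‿cong (*-congˡ (κ-Simple s))) ⟩
    powℕ q (absent (mem (v ++ a ∷ [])) n) * carry (mem (v ++ a ∷ [])) n - p * (powℕ q (absent V n) * k)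
      ≡⟨ cong₂ (λ s t → powℕ q s * t - p * (powℕ q (absent V n) * k))
           (absent-cong n (λ c _ → mem-∷ʳ v a c)) (carry-cong n (λ c _ → mem-∷ʳ v a c)) ⟩
    Q * carry (V ⊕ a) n - p * (powℕ q (absent V n) * k)
      ≈⟨ +-congʳ (*-congˡ (carry-⊕≥ V n a∉v 1≤a a≤n)) ⟩
    Q * (k + W V a * (powℕ p (absent V n) * powℕ q (absent V a))) - p * (powℕ q (absent V n) * k)
      ≡⟨ cong₂ (λ s t → Q * (k + W V a * (powℕ p s * powℕ q t)) - p * (powℕ q s * k))
           (≡.sym (absent-⊕≥ V n a∉v 1≤a a≤n)) (absent-pred V 1≤a a∉v) ⟩
    Q * (k + W V a * ((p * P′) * (q * y))) - p * ((q * Q) * k)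
      ≈⟨ solve 7 (λ q p Q P′ k w y → Q :* (k :+ w :* ((p :* P′) :* (q :* y))) :- p :* ((q :* Q) :* k)
           := (q :* p) :* (Q :* P′) :* (y :* w) :+ (con (+ 1) :- q :* p) :* (Q :* k)) refl q p Q P′ k (W V a) y ⟩
    (q * p) * (Q * P′) * (y * W V a) + (1# - q * p) * (Q * k)
      ≈⟨ +-cong (*-congʳ (*-cong qp≈1 (qᵏpᵏ≈1 (absent (V ⊕ a) n)))) (*-congʳ (+-congˡ (-‿cong qp≈1))) ⟩
    1# * 1# * (y * W V a) + (1# - 1#) * (Q * k)
      ≈⟨ solve 2 (λ a b → con (+ 1) :* con (+ 1) :* a :+ (con (+ 1) :- con (+ 1)) :* b := a) refl (y * W V a) (Q * k) ⟩
    y * W V a ∎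
    where
    V = mem v
    k = carry V n
    Q = powℕ q (absent (V ⊕ a) n)
    P′ = powℕ p (absent (V ⊕ a) n)
    y = powℕ q (absent V (a ∸ 1))

  weight : (ℕ → Bool) → ℕ → Carrier
  weight U a = powℕ q (absent U (a ∸ 1)) * W U a

  weight-cong : ∀ {U V} a → (∀ c → c ≤ a ∸ 1 → U c ≡ V c) → weight U a ≡ weight V a
  weight-cong a eq = cong₂ (λ z w → powℕ q z * w) (absent-cong (a ∸ 1) eq) (W-cong a eq)

  weight-pos : ∀ U a → 1 ≤ a → a ≤ n → 0# < weight U a
  weight-pos U a 1≤a a≤n = *-pos (powℕ-pos 0<q (absent U (a ∸ 1))) (W-pos U a 1≤a a≤n)

  Nfac-middle : ∀ u a w → Simple n u → 1 ≤ a × a ≤ n → mem u a ≡ false →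
    Nfac (u ++ a ∷ w) (suc (length u)) ≈ weight (mem u) a
  Nfac-middle u a w s r@(1≤a , _) a∉u with sliceView u a w s a∉u
  ... | lrm min above rewrite min | at-middle u a w = begin
    -- Since `κ []` is 0, a left-to-right minimum also has the difference form, with an empty slice.
    κ (a ∷ [])                   ≈⟨ solve 2 (λ k p → k := k :- p :* con (+ 0)) refl (κ (a ∷ [])) p ⟩
    κ (a ∷ []) - p * κ []        ≈⟨ κ-∷ʳ [] r ≡.refl ⟩
    weight ∅ a                   ≡⟨ weight-cong a (λ c c≤ → ≡.sym (above c (≤pred⇒< 1≤a c≤))) ⟩
    weight (mem u) a             ∎
  ... | non-lrm i v nmin pos sl₁ sl₂ agree a∉v sv rewrite nmin | pos | sl₁ | sl₂ =
    trans (κ-∷ʳ sv r a∉v) (reflexive (weight-cong a (λ c c≤ → agree c (≤pred⇒< 1≤a c≤))))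

  module _ {π} (word : Word n n π) (dπ : distinct π ≡ true) where
    simple : Simple n π
    simple = distinct⇒Simple (proj₂ word) dπ

    enumerates : Enumerates n ∅ π
    enumerates = Simple⇒Enumerates simple (λ _ _ → ≡.refl) (≡.trans (absent-∅ n) (≡.sym (proj₁ word)))

    module _ k (k<n : k ℕ.< n) where
      private
        split  = split-at k π (subst (k ℕ.<_) (≡.sym (proj₁ word)) k<n)
        simple′ = subst (Simple n) (≡.sym (proj₁ split)) simple

      simple-prefix : Simple n (take k π)
      simple-prefix = Simple-++ˡ (take k π) simple′

      next-letter : (1 ≤ at π (suc k) × at π (suc k) ≤ n) × mem (take k π) (at π (suc k)) ≡ false
      next-letter = Simple-++-middle (take k π) simple′

      Dfac-perm : Dfac π (suc k) ≈ D (mem (take k π))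
      Dfac-perm = Dfac≈D π k simple-prefix (proj₂ split)

      Nfac-perm : Nfac π (suc k) ≈ weight (mem (take k π)) (at π (suc k))
      Nfac-perm = trans (reflexive (cong₂ Nfac (≡.sym (proj₁ split)) (cong suc (≡.sym (proj₂ split)))))
        (Nfac-middle (take k π) (at π (suc k)) (drop (suc k) π) simple-prefix (proj₁ next-letter) (proj₂ next-letter))

      Dfac-pos : 0# < Dfac π (suc k)
      Dfac-pos = <-respʳ (sym Dfac-perm) (D-pos (mem (take k π)) (proj₂ next-letter)
        (proj₁ (proj₁ next-letter)) (proj₂ (proj₁ next-letter)))

      Nfac-pos : 0# < Nfac π (suc k)
      Nfac-pos = <-respʳ (sym Nfac-perm) (weight-pos (mem (take k π)) (at π (suc k))
        (proj₁ (proj₁ next-letter)) (proj₂ (proj₁ next-letter)))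

  -- The last factor of R is 1, so the products stop one letter before the end.
  R-products : ∀ {U w} → Enumerates n U w →
    powℕ q (inv w) * (R U w * ∏ (range (length w ∸ 1)) (λ k → D (U ⊕* take (k ∸ 1) w)))
      ≈ ∏ (range (length w ∸ 1)) (λ k → weight (U ⊕* take (k ∸ 1) w) (at w k))
  R-products {U} ([] _) = solve 0 (con (+ 1) :* (con (+ 1) :* con (+ 1)) := con (+ 1)) refl
  R-products {U} {a ∷ []} e = begin
    1# * (P U a * 1# * 1#)   ≈⟨ solve 1 (λ t → con (+ 1) :* (t :* con (+ 1) :* con (+ 1)) := t) refl (P U a) ⟩
    P U a                    ≈⟨ P-last e ⟩
    1#                       ∎
  R-products {U} {a ∷ w@(b ∷ w′)} e@(((1≤a , a≤n) , Ua) ∷ e′) = begin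
    powℕ q (inv (a ∷ w)) * (P U a * R (U ⊕ a) w * ∏ (range (length w)) (λ k → D (U ⊕* take (k ∸ 1) (a ∷ w))))
      ≈⟨ *-cong (trans (reflexive (cong (powℕ q) (inv-∷ e))) (powℕ-+ q (absent U (a ∸ 1)) (inv w)))
           (*-congˡ (trans (reflexive (∏-head (length w′) _)) (*-congˡ (∏-range-cong (length w′) shift-D)))) ⟩
    (y * powℕ q (inv w)) * (W U a * (D U) ⁻¹ * R (U ⊕ a) w * (D U * ∏D))
      ≈⟨ solve 7 (λ y Q w i r d m → (y :* Q) :* (w :* i :* r :* (d :* m)) := (y :* w) :* (Q :* (r :* m)) :* (d :* i))
           refl y (powℕ q (inv w)) (W U a) ((D U) ⁻¹) (R (U ⊕ a) w) (D U) ∏D ⟩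
    weight U a * (powℕ q (inv w) * (R (U ⊕ a) w * ∏D)) * (D U * (D U) ⁻¹)
      ≈⟨ *-cong (*-congˡ (R-products e′)) (⁻¹-inverse _ (pos⇒≉0 (D-pos U Ua 1≤a a≤n))) ⟩
    weight U a * ∏ (range (length w′)) (λ k → weight ((U ⊕ a) ⊕* take (k ∸ 1) w) (at w k)) * 1#
      ≈⟨ *-identityʳ _ ⟩
    weight U a * ∏ (range (length w′)) (λ k → weight ((U ⊕ a) ⊕* take (k ∸ 1) w) (at w k))
      ≈⟨ *-congˡ (∏-range-cong (length w′) shift-weight) ⟨
    weight U a * ∏ (range (length w′)) (λ k → weight (U ⊕* take k (a ∷ w)) (at (a ∷ w) (suc k)))
      ≡⟨ ∏-head (length w′) (λ k → weight (U ⊕* take (k ∸ 1) (a ∷ w)) (at (a ∷ w) k)) ⟨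
    ∏ (range (length w)) (λ k → weight (U ⊕* take (k ∸ 1) (a ∷ w)) (at (a ∷ w) k)) ∎
    where
    y = powℕ q (absent U (a ∸ 1))
    ∏D = ∏ (range (length w′)) (λ k → D ((U ⊕ a) ⊕* take (k ∸ 1) w))
    shift-D : ∀ k → 1 ≤ k → k ≤ length w′ → D (U ⊕* take k (a ∷ w)) ≈ D ((U ⊕ a) ⊕* take (k ∸ 1) w)
    shift-D (suc k) _ _ = refl
    shift-weight : ∀ k → 1 ≤ k → k ≤ length w′ →
      weight (U ⊕* take k (a ∷ w)) (at (a ∷ w) (suc k)) ≈ weight ((U ⊕ a) ⊕* take (k ∸ 1) w) (at w k)
    shift-weight (suc k) _ _ = refl

  ∏-pos : ∀ m f → (∀ k → 1 ≤ k → k ≤ m → 0# < f k) → 0# < ∏ (range m) f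
  ∏-pos zero    f pos = 0<1
  ∏-pos (suc m) f pos = <-respʳ (sym (∏-last m f)) (*-pos
    (∏-pos m f (λ k 1≤k k≤m → pos k 1≤k (ℕ.m≤n⇒m≤1+n k≤m))) (pos (suc m) (s≤s z≤n) ℕ.≤-refl))

  <-of-≤pred : ∀ {k m} → suc k ≤ m ∸ 1 → k ℕ.< m
  <-of-≤pred {m = suc m} k<m = ℕ.m≤n⇒m≤1+n k<m

  Ψ≈R : ∀ {π} → Word n n π → distinct π ≡ true → Ψ π ≈ R ∅ π
  Ψ≈R {π} word dπ = begin
    qpow (ℤ.- (+ inv π)) * (∏N * (∏D) ⁻¹)
      ≈⟨ *-cong (reflexive (qpow-neg (inv π))) (*-congʳ ∏N≈) ⟩
    powℕ p (inv π) * ((powℕ q (inv π) * (R ∅ π * ∏D)) * (∏D) ⁻¹)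
      ≈⟨ solve 5 (λ p q r d i → p :* ((q :* (r :* d)) :* i) := (q :* p) :* (d :* i) :* r) refl
           (powℕ p (inv π)) (powℕ q (inv π)) (R ∅ π) ∏D ((∏D) ⁻¹) ⟩
    (powℕ q (inv π) * powℕ p (inv π)) * (∏D * (∏D) ⁻¹) * R ∅ π
      ≈⟨ *-congʳ (*-cong (qᵏpᵏ≈1 (inv π)) (⁻¹-inverse ∏D (pos⇒≉0 (∏-pos (n ∸ 1) (Dfac π) pos-D)))) ⟩
    1# * 1# * R ∅ π
      ≈⟨ solve 1 (λ r → con (+ 1) :* con (+ 1) :* r := r) refl (R ∅ π) ⟩
    R ∅ π ∎
    where
    ∏N = ∏ (range (n ∸ 1)) (Nfac π)
    ∏D = ∏ (range (n ∸ 1)) (Dfac π)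
    pos-D : ∀ k → 1 ≤ k → k ≤ n ∸ 1 → 0# < Dfac π k
    pos-D (suc k) _ k≤ = Dfac-pos word dπ k (<-of-≤pred k≤)
    D≈ : ∀ k → 1 ≤ k → k ≤ n ∸ 1 → D (∅ ⊕* take (k ∸ 1) π) ≈ Dfac π k
    D≈ (suc k) _ k≤ = trans (reflexive (D-cong (∅⊕*≡mem (take k π)))) (sym (Dfac-perm word dπ k (<-of-≤pred k≤)))
    N≈ : ∀ k → 1 ≤ k → k ≤ n ∸ 1 → weight (∅ ⊕* take (k ∸ 1) π) (at π k) ≈ Nfac π k
    N≈ (suc k) _ k≤ = trans (reflexive (weight-cong (at π (suc k)) (λ c _ → ∅⊕*≡mem (take k π) c))) (sym (Nfac-perm word dπ k (<-of-≤pred k≤)))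
    products : powℕ q (inv π) * (R ∅ π * ∏ (range (n ∸ 1)) (λ k → D (∅ ⊕* take (k ∸ 1) π)))
      ≈ ∏ (range (n ∸ 1)) (λ k → weight (∅ ⊕* take (k ∸ 1) π) (at π k))
    products = subst (λ m → powℕ q (inv π) * (R ∅ π * ∏ (range (m ∸ 1)) (λ k → D (∅ ⊕* take (k ∸ 1) π)))
      ≈ ∏ (range (m ∸ 1)) (λ k → weight (∅ ⊕* take (k ∸ 1) π) (at π k))) (proj₁ word) (R-products (enumerates word dπ))
    ∏N≈ : ∏N ≈ powℕ q (inv π) * (R ∅ π * ∏D)
    ∏N≈ = trans (sym (∏-range-cong (n ∸ 1) N≈)) (trans (sym products) (*-congˡ (*-congˡ (∏-range-cong (n ∸ 1) D≈))))

  -- Once the first letter is fixed the rest has mass 1 by induction, and the first-letter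
  -- probabilities sum to 1 by `∑-W`. The letter from `absent-witness` makes `D U` nonzero.
  ∑-R : ∀ k U → absent U n ≡ k → ∑ (words n k) (λ w → if good U w then R U w else 0#) ≈ 1#
  ∑-R zero    U eq = +-identityʳ 1#
  ∑-R (suc k) U eq with absent-witness U n eq
  ... | d , (1≤d , d≤n) , Ud = begin
    ∑ (words n (suc k)) (λ w → if good U w then R U w else 0#)
      ≈⟨ ∑-words-head k _ ⟩
    ∑ (range n) (λ a → ∑ (words n k) (λ w → if good U (a ∷ w) then R U (a ∷ w) else 0#))
      ≈⟨ ∑-range-cong n first-letter ⟩
    ∑ (range n) (λ a → (D U) ⁻¹ * (if U a then 0# else W U a))
      ≈⟨ *-distribˡ-∑ (range n) ((D U) ⁻¹) _ ⟨
    (D U) ⁻¹ * ∑ (range n) (λ a → if U a then 0# else W U a)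
      ≈⟨ trans (*-congˡ (∑-W U n)) (*-comm _ _) ⟩
    D U * (D U) ⁻¹
      ≈⟨ ⁻¹-inverse (D U) (pos⇒≉0 (D-pos U Ud 1≤d d≤n)) ⟩
    1# ∎
    where
    first-letter : ∀ a → 1 ≤ a → a ≤ n →
      ∑ (words n k) (λ w → if good U (a ∷ w) then R U (a ∷ w) else 0#) ≈ (D U) ⁻¹ * (if U a then 0# else W U a)
    first-letter a 1≤a a≤n with U a in Ua
    ... | true  = trans (∑-zero (words n k)) (sym (zeroʳ _))
    ... | false = begin
      ∑ (words n k) (λ w → if good (U ⊕ a) w then P U a * R (U ⊕ a) w else 0#)
        ≈⟨ ∑-cong (words n k) (λ w → scale (good (U ⊕ a) w) (R (U ⊕ a) w)) ⟩
      ∑ (words n k) (λ w → P U a * (if good (U ⊕ a) w then R (U ⊕ a) w else 0#))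
        ≈⟨ *-distribˡ-∑ (words n k) (P U a) _ ⟨
      P U a * ∑ (words n k) (λ w → if good (U ⊕ a) w then R (U ⊕ a) w else 0#)
        ≈⟨ *-congˡ (∑-R k (U ⊕ a) (ℕ.suc-injective (≡.trans (absent-⊕≥ U n Ua 1≤a a≤n) eq))) ⟩
      P U a * 1#
        ≈⟨ trans (*-identityʳ _) (*-comm _ _) ⟩
      (D U) ⁻¹ * W U a ∎
      where
      scale : ∀ b r → (if b then P U a * r else 0#) ≈ P U a * (if b then r else 0#)
      scale true  r = refl
      scale false r = sym (zeroʳ _)

  normalised : ∑ (Sn n) Ψ ≈ 1#
  normalised = begin
    ∑ (Sn n) Ψ                                                      ≈⟨ ∑-Sn-cong (λ _ → Ψ≈R) ⟩
    ∑ (Sn n) (R ∅)                                                  ≈⟨ ∑-Sn (R ∅) ⟩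
    ∑ (words n n) (λ w → if distinct w then R ∅ w else 0#)          ≈⟨ ∑-cong (words n n) (λ w → reflexive (cong (λ e → if e then R ∅ w else 0#) (distinct≡good w))) ⟩
    ∑ (words n n) (λ w → if good ∅ w then R ∅ w else 0#)            ≈⟨ ∑-R n ∅ (absent-∅ n) ⟩
    1#                                                              ∎

  carry-∅ : ∀ m → carry ∅ m ≈ 0#
  carry-∅ zero    = refl
  carry-∅ (suc m) = trans (*-congˡ (carry-∅ m)) (zeroʳ p)

  -- With nothing used every carry vanishes, so the first letter is drawn in proportion to `x`.
  sumX*P : ∀ {a} → 1 ≤ a → a ≤ n → sumX * P ∅ a ≈ x a
  sumX*P {a} 1≤a a≤n = begin
    sumX * (W ∅ a * (D ∅) ⁻¹)
      ≈⟨ *-cong (trans (solve 1 (λ s → s := s :- con (+ 0)) refl sumX) (+-congˡ (-‿cong (sym (carry-∅ n)))))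
           (*-congʳ (+-congˡ (*-congˡ (carry-∅ (a ∸ 1))))) ⟩
    D ∅ * ((x a + (1# - p) * 0#) * (D ∅) ⁻¹)
      ≈⟨ solve 4 (λ d y p i → d :* ((y :+ (con (+ 1) :- p) :* con (+ 0)) :* i) := y :* (d :* i)) refl (D ∅) (x a) p ((D ∅) ⁻¹) ⟩
    x a * (D ∅ * (D ∅) ⁻¹)
      ≈⟨ trans (*-congˡ (⁻¹-inverse (D ∅) (pos⇒≉0 (D-pos ∅ {a} ≡.refl 1≤a a≤n)))) (*-identityʳ _) ⟩
    x a ∎

  -- The power of `q` left by re-insertion is cancelled by the one that the diagonal map attaches to
  -- the first letter.
  γ-∅ : ∀ {a} → a ≤ n → γ ∅ a * powℕ p (n ∸ a) ≈ 1#
  γ-∅ {a} a≤n = begin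
    powℕ q (absent ∅ n) * powℕ p (absent ∅ a) * powℕ p (n ∸ a)
      ≡⟨ cong₂ (λ s t → powℕ q s * powℕ p t * powℕ p (n ∸ a)) (absent-∅ n) (absent-∅ a) ⟩
    powℕ q n * powℕ p a * powℕ p (n ∸ a)
      ≈⟨ trans (*-assoc _ _ _) (*-congˡ (sym (powℕ-+ p a (n ∸ a)))) ⟩
    powℕ q n * powℕ p (a ℕ.+ (n ∸ a))
      ≡⟨ cong (λ m → powℕ q n * powℕ p m) (ℕ.m+[n∸m]≡n a≤n) ⟩
    powℕ q n * powℕ p n
      ≈⟨ qᵏpᵏ≈1 n ⟩
    1# ∎

  stationary : 1 ≤ n → ∀ {σ} → Word n n σ → distinct σ ≡ true →
    ∑ (Sn n) (λ π → Ψ π * M π σ) ≈ sumX * Ψ σ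
  stationary 1≤n {[]}    (len , _) _ = ⊥-elim (ℕ.<⇒≢ 1≤n len)
  stationary 1≤n {a ∷ w} word dσ with enumerates word dσ
  ... | e@(((1≤a , a≤n) , _) ∷ _) = begin
    ∑ (Sn n) (λ π → Ψ π * M π (a ∷ w))
      ≈⟨ ∑-Sn-cong (λ π wπ dπ → *-congʳ (Ψ≈R wπ dπ)) ⟩
    ∑ (Sn n) (λ π → R ∅ π * M π (a ∷ w))
      ≈⟨ row-action (R ∅) 1≤n word dσ ⟩
    horner (n ∸ 1) 0 (R ∅) (a ∷ w) * ξ (a ∷ w)
      ≡⟨ cong₂ (λ m t → horner (m ∸ 1) 0 (R ∅) (a ∷ w) * (x a * t)) (≡.sym (proj₁ word)) (qpow-neg (n ∸ a)) ⟩
    horner (length w) 0 (R ∅) (a ∷ w) * (x a * powℕ p (n ∸ a))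
      ≈⟨ *-congʳ (horner-R w a ∅ e) ⟩
    γ ∅ a * R (∅ ⊕ a) w * (x a * powℕ p (n ∸ a))
      ≈⟨ solve 4 (λ g r y t → g :* r :* (y :* t) := (g :* t) :* (y :* r)) refl (γ ∅ a) (R (∅ ⊕ a) w) (x a) (powℕ p (n ∸ a)) ⟩
    (γ ∅ a * powℕ p (n ∸ a)) * (x a * R (∅ ⊕ a) w)
      ≈⟨ trans (*-congʳ (γ-∅ a≤n)) (*-identityˡ _) ⟩
    x a * R (∅ ⊕ a) w
      ≈⟨ trans (*-congʳ (sym (sumX*P 1≤a a≤n))) (*-assoc _ _ _) ⟩
    sumX * R ∅ (a ∷ w)
      ≈⟨ *-congˡ (sym (Ψ≈R word dσ)) ⟩
    sumX * Ψ (a ∷ w) ∎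

theorem2p6 : ∀ {c ℓ : Level} (F : OrderedField c ℓ) → let open OrderedField F in
    (n : ℕ) → 1 ≤ n →
    (q : Carrier) → 1# ≤F q →
    (x : ℕ → Carrier) → (∀ i → 1 ≤ i → i ≤ n → 0# < x i) →
    Tsetlin.sumX F q x n ≈ 1# →
    let open Tsetlin F q x n in
    (∀ σ → σ ∈ Sn n → sumF (map (λ π → Ψ π * M π σ) (Sn n)) ≈ sumX * Ψ σ)
    × (∀ π → π ∈ Sn n → ∀ k → 1 ≤ k → k ≤ n ∸ 1 → (0# < Dfac π k) × (0# < Nfac π k))
    × (sumF (map Ψ (Sn n)) ≈ 1#)
theorem2p6 F n 1≤n q 1≤q x x-pos _ = stationarity , positivity , normalised
  where
  open OrderedField F
  open Tsetlin F q x n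
  open StationaryDistribution F q x n 1≤q x-pos

  stationarity : ∀ σ → σ ∈ Sn n → sumF (map (λ π → Ψ π * M π σ) (Sn n)) ≈ sumX * Ψ σ
  stationarity σ σ∈ with ∈-Sn σ∈
  ... | word , dσ = stationary 1≤n word dσ

  positivity : ∀ π → π ∈ Sn n → ∀ k → 1 ≤ k → k ≤ n ∸ 1 → (0# < Dfac π k) × (0# < Nfac π k)
  positivity π π∈ (suc k) _ k≤ with ∈-Sn π∈
  ... | word , dπ = Dfac-pos word dπ k (<-of-≤pred k≤) , Nfac-pos word dπ k (<-of-≤pred k≤)
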